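{- For every integer $m \ge 2$, $d(m, 4m+1) \le 1260$.
   Context: An integral point set in $\mathbb{R}^m$ is a finite set $\mathcal{P}$ of points of the $m$-dimensional Euclidean space $\mathbb{R}^m$ such that the Euclidean distance between any two points of $\mathcal{P}$ is an integer and $\mathcal{P}$ is not contained in an $(m-1)$-dimensional (affine) hyperplane. Its diameter is $\operatorname{diam}(\mathcal{P}) = \max_{P_1, P_2 \in \mathcal{P}} |P_1P_2|$. The function $d(m,n)$ is the minimal possible diameter of an integral point set of $n$ points in $\mathbb{R}^m$. -}

module Defs where

open import Data.Nat.Base as ℕ using (ℕ; zero; suc)
import Data.Nat.Properties as ℕₚ
open import Data.Integer.Base as ℤ using (ℤ; +_)
import Data.Integer.Properties as ℤₚ
open import Data.Rational.Base as ℚ using (ℚ; 0ℚ; 1ℚ; ½; ∣_∣; NonNegative; Positive)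
import Data.Rational.Properties as ℚₚ
open import Data.Rational.Solver using (module +-*-Solver)
import Data.Rational.Unnormalised.Base as ℚᵘ
import Data.Rational.Unnormalised.Properties as ℚᵘₚ
open import Data.Fin.Base using (Fin)
open import Data.Vec.Functional using (Vector; foldr)
open import Data.Product.Base using (Σ; ∃; ∃₂; ∃-syntax; _×_; _,_; proj₁; proj₂)
open import Data.Sum.Base using (_⊎_; inj₁; inj₂)
open import Relation.Nullary using (¬_; Dec; yes; no; contradiction)
open import Relation.Binary.PropositionalEquality

open +-*-Solver using (solve; _:=_; _:+_; _:*_; _:-_; :-_; con)

------------------------------------------------------------------------
-- Rational estimates

0<½*_ : ∀ {ε} → 0ℚ ℚ.< ε → 0ℚ ℚ.< ½ ℚ.* ε
0<½*_ {ε} 0<ε = subst (ℚ._< ½ ℚ.* ε) (ℚₚ.*-zeroʳ ½) (ℚₚ.*-monoʳ-<-pos ½ 0<ε)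

½+½ : ∀ ε → ½ ℚ.* ε ℚ.+ ½ ℚ.* ε ≡ ε
½+½ ε = trans (sym (ℚₚ.*-distribʳ-+ ε ½ ½)) (ℚₚ.*-identityˡ ε)

½*ε<ε : ∀ {ε} → 0ℚ ℚ.< ε → ½ ℚ.* ε ℚ.< ε
½*ε<ε {ε} 0<ε = subst₂ ℚ._<_ (ℚₚ.+-identityʳ _) (½+½ ε) (ℚₚ.+-monoʳ-< (½ ℚ.* ε) (0<½* 0<ε))

<⇒≱ : ∀ {p q} → p ℚ.< q → ¬ (q ℚ.≤ p)
<⇒≱ p<q q≤p = ℚₚ.<-irrefl refl (ℚₚ.<-≤-trans p<q q≤p)

p≤∣p∣ : ∀ p → p ℚ.≤ ∣ p ∣
p≤∣p∣ p with ℚₚ.≤-total 0ℚ p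
... | inj₁ 0≤p = ℚₚ.≤-reflexive (sym (ℚₚ.0≤p⇒∣p∣≡p 0≤p))
... | inj₂ p≤0 = ℚₚ.≤-trans p≤0 (ℚₚ.0≤∣p∣ p)

∣p-q∣≡∣q-p∣ : ∀ p q → ∣ p ℚ.- q ∣ ≡ ∣ q ℚ.- p ∣
∣p-q∣≡∣q-p∣ p q = trans (cong ∣_∣ (solve 2 (λ p q → p :- q := :- (q :- p)) refl p q))
                        (ℚₚ.∣-p∣≡∣p∣ (q ℚ.- p))

∣p-q∣<ε⇒p<q+ε : ∀ {p q ε} → ∣ p ℚ.- q ∣ ℚ.< ε → p ℚ.< q ℚ.+ ε
∣p-q∣<ε⇒p<q+ε {p} {q} {ε} h =
  subst (ℚ._< q ℚ.+ ε) (solve 2 (λ p q → q :+ (p :- q) := p) refl p q)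
    (ℚₚ.+-monoʳ-< q (ℚₚ.≤-<-trans (p≤∣p∣ (p ℚ.- q)) h))

p<q+ε⇒p-q<ε : ∀ {p q ε} → p ℚ.< q ℚ.+ ε → p ℚ.- q ℚ.< ε
p<q+ε⇒p-q<ε {p} {q} {ε} h =
  subst (p ℚ.- q ℚ.<_) (solve 2 (λ q ε → (q :+ ε) :- q := ε) refl q ε)
    (ℚₚ.+-monoˡ-< (ℚ.- q) h)

∣p-q∣<ε : ∀ {p q ε} → p ℚ.< q ℚ.+ ε → q ℚ.< p ℚ.+ ε → ∣ p ℚ.- q ∣ ℚ.< ε
∣p-q∣<ε {p} {q} {ε} h k with ℚₚ.∣p∣≡p∨∣p∣≡-p (p ℚ.- q)
... | inj₁ eq = subst (ℚ._< ε) (sym eq) (p<q+ε⇒p-q<ε h)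
... | inj₂ eq = subst (ℚ._< ε)
  (sym (trans eq (solve 2 (λ p q → :- (p :- q) := q :- p) refl p q))) (p<q+ε⇒p-q<ε k)

*-mono-≤-nonNeg : ∀ {p q r s} → 0ℚ ℚ.≤ q → 0ℚ ℚ.≤ r → p ℚ.≤ q → r ℚ.≤ s → p ℚ.* r ℚ.≤ q ℚ.* s
*-mono-≤-nonNeg {p} {q} {r} {s} 0≤q 0≤r p≤q r≤s = ℚₚ.≤-trans
  (ℚₚ.*-monoʳ-≤-nonNeg r {{ℚ.nonNegative 0≤r}} p≤q)
  (ℚₚ.*-monoˡ-≤-nonNeg q {{ℚ.nonNegative 0≤q}} r≤s)

0≤p*p : ∀ p → 0ℚ ℚ.≤ p ℚ.* p
0≤p*p p with ℚₚ.≤-total 0ℚ p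
... | inj₁ 0≤p = *-mono-≤-nonNeg 0≤p ℚₚ.≤-refl 0≤p 0≤p
... | inj₂ p≤0 = subst (0ℚ ℚ.≤_) (solve 1 (λ p → (:- p) :* (:- p) := p :* p) refl p)
                   (*-mono-≤-nonNeg 0≤-p ℚₚ.≤-refl 0≤-p 0≤-p)
  where 0≤-p = ℚₚ.neg-antimono-≤ p≤0

-- 1 / (n + 1)
step : ℕ → ℚ
step n = + 1 ℚ./ suc n

0<step : ∀ n → 0ℚ ℚ.< step n
0<step n = ℚₚ.positive⁻¹ (step n) {{ℚₚ.normalize-pos 1 (suc n)}}

step-archimedean : ∀ ε → 0ℚ ℚ.< ε → ∃[ N ] (∀ n → N ℕ.≤ n → step n ℚ.≤ ε)
step-archimedean ε@(ℚ.mkℚ (+ suc a) d _) _ = d , λ n d≤n → ℚₚ.toℚᵘ-cancel-≤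
  (ℚᵘₚ.≤-respˡ-≃ (ℚᵘₚ.≃-sym (ℚₚ.toℚᵘ-fromℚᵘ (ℚᵘ.mkℚᵘ (+ 1) n)))
    (ℚᵘ.*≤* (ℤ.+≤+ (ℕₚ.≤-trans
      (ℕₚ.≤-reflexive (ℕₚ.*-identityˡ (suc d)))
      (ℕₚ.≤-trans (ℕ.s≤s d≤n) (ℕₚ.m≤m+n (suc n) (a ℕ.* suc n)))))))
step-archimedean (ℚ.mkℚ (+ zero) d _) (ℚ.*<* (ℤ.+<+ ()))
step-archimedean (ℚ.mkℚ (ℤ.-[1+ a ]) d _) (ℚ.*<* ())

fromℕ : ℕ → ℚ
fromℕ n = + n ℚ./ 1

fromℕ-suc : ∀ n → fromℕ (suc n) ≡ 1ℚ ℚ.+ fromℕ n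
fromℕ-suc n = ℚₚ.toℚᵘ-injective (begin
  ℚ.toℚᵘ (fromℕ (suc n))                  ≈⟨ ℚₚ.toℚᵘ-fromℚᵘ (ℚᵘ.mkℚᵘ (+ suc n) 0) ⟩
  ℚᵘ.mkℚᵘ (+ suc n) 0                      ≈⟨ ℚᵘ.*≡* (cong (λ k → (+ 1 ℤ.+ k) ℤ.* + 1) (sym (ℤₚ.*-identityʳ (+ n)))) ⟩
  ℚᵘ.1ℚᵘ ℚᵘ.+ ℚᵘ.mkℚᵘ (+ n) 0              ≈⟨ ℚᵘₚ.+-congʳ ℚᵘ.1ℚᵘ (ℚᵘₚ.≃-sym (ℚₚ.toℚᵘ-fromℚᵘ (ℚᵘ.mkℚᵘ (+ n) 0))) ⟩
  ℚᵘ.1ℚᵘ ℚᵘ.+ ℚ.toℚᵘ (fromℕ n)             ≈⟨ ℚᵘₚ.≃-sym (ℚₚ.toℚᵘ-homo-+ 1ℚ (fromℕ n)) ⟩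
  ℚ.toℚᵘ (1ℚ ℚ.+ fromℕ n)                  ∎)
  where open ℚᵘₚ.≃-Reasoning

0≤fromℕ : ∀ n → 0ℚ ℚ.≤ fromℕ n
0≤fromℕ n = ℚₚ.nonNegative⁻¹ (fromℕ n) {{ℚₚ.normalize-nonNeg n 1}}

fromℕ-+ : ∀ m n → fromℕ (m ℕ.+ n) ≡ fromℕ m ℚ.+ fromℕ n
fromℕ-+ zero    n = sym (ℚₚ.+-identityˡ (fromℕ n))
fromℕ-+ (suc m) n = begin
  fromℕ (suc (m ℕ.+ n))             ≡⟨ fromℕ-suc (m ℕ.+ n) ⟩
  1ℚ ℚ.+ fromℕ (m ℕ.+ n)            ≡⟨ cong (1ℚ ℚ.+_) (fromℕ-+ m n) ⟩
  1ℚ ℚ.+ (fromℕ m ℚ.+ fromℕ n)      ≡⟨ ℚₚ.+-assoc 1ℚ (fromℕ m) (fromℕ n) ⟨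
  (1ℚ ℚ.+ fromℕ m) ℚ.+ fromℕ n      ≡⟨ cong (ℚ._+ fromℕ n) (fromℕ-suc m) ⟨
  fromℕ (suc m) ℚ.+ fromℕ n         ∎
  where open ≡-Reasoning

fromℕ-* : ∀ m n → fromℕ (m ℕ.* n) ≡ fromℕ m ℚ.* fromℕ n
fromℕ-* zero    n = sym (ℚₚ.*-zeroˡ (fromℕ n))
fromℕ-* (suc m) n = begin
  fromℕ (n ℕ.+ m ℕ.* n)                       ≡⟨ fromℕ-+ n (m ℕ.* n) ⟩
  fromℕ n ℚ.+ fromℕ (m ℕ.* n)                 ≡⟨ cong (fromℕ n ℚ.+_) (fromℕ-* m n) ⟩
  fromℕ n ℚ.+ fromℕ m ℚ.* fromℕ n             ≡⟨ solve 2 (λ m n → n :+ m :* n := (con 1ℚ :+ m) :* n) refl (fromℕ m) (fromℕ n) ⟩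
  (1ℚ ℚ.+ fromℕ m) ℚ.* fromℕ n                ≡⟨ cong (ℚ._* fromℕ n) (fromℕ-suc m) ⟨
  fromℕ (suc m) ℚ.* fromℕ n                   ∎
  where open ≡-Reasoning

suc*step≡1 : ∀ n → fromℕ (suc n) ℚ.* step n ≡ 1ℚ
suc*step≡1 n = ℚₚ.toℚᵘ-injective (begin
  ℚ.toℚᵘ (fromℕ (suc n) ℚ.* step n)                  ≈⟨ ℚₚ.toℚᵘ-homo-* (fromℕ (suc n)) (step n) ⟩
  ℚ.toℚᵘ (fromℕ (suc n)) ℚᵘ.* ℚ.toℚᵘ (step n)        ≈⟨ ℚᵘₚ.*-cong (ℚₚ.toℚᵘ-fromℚᵘ (ℚᵘ.mkℚᵘ (+ suc n) 0)) (ℚₚ.toℚᵘ-fromℚᵘ (ℚᵘ.mkℚᵘ (+ 1) n)) ⟩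
  ℚᵘ.mkℚᵘ (+ suc n) 0 ℚᵘ.* ℚᵘ.mkℚᵘ (+ 1) n           ≈⟨ ℚᵘ.*≡* (cong +_ lemma) ⟩
  ℚᵘ.1ℚᵘ                                             ∎)
  where
  open ℚᵘₚ.≃-Reasoning
  lemma : suc n ℕ.* 1 ℕ.* 1 ≡ 1 ℕ.* (1 ℕ.* suc n)
  lemma = trans (ℕₚ.*-identityʳ _) (trans (ℕₚ.*-identityʳ _)
    (sym (trans (ℕₚ.*-identityˡ _) (ℕₚ.*-identityˡ _))))

≤-fromℕ-numerator : ∀ q → q ℚ.≤ fromℕ ℤ.∣ ℚ.↥ q ∣
≤-fromℕ-numerator q@(ℚ.mkℚ n d _) = ℚₚ.toℚᵘ-cancel-≤
  (ℚᵘₚ.≤-respʳ-≃ (ℚᵘₚ.≃-sym (ℚₚ.toℚᵘ-fromℚᵘ (ℚᵘ.mkℚᵘ (+ ℤ.∣ n ∣) 0))) (ℚᵘ.*≤* (lemma n)))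
  where
  lemma : ∀ n → n ℤ.* + 1 ℤ.≤ + ℤ.∣ n ∣ ℤ.* + suc d
  lemma (+ n) = subst₂ ℤ._≤_ (ℤₚ.pos-* n 1) (ℤₚ.pos-* n (suc d))
    (ℤ.+≤+ (ℕₚ.*-monoʳ-≤ n (ℕ.s≤s ℕ.z≤n)))
  lemma ℤ.-[1+ n ] = ℤ.-≤+

------------------------------------------------------------------------
-- Real numbers

IsCauchy : (ℕ → ℚ) → Set
IsCauchy x = ∀ ε → 0ℚ ℚ.< ε →
  ∃[ N ] (∀ i j → N ℕ.≤ i → N ℕ.≤ j → ∣ x i ℚ.- x j ∣ ℚ.< ε)

record ℝ : Set where
  constructor mkℝ
  field
    seq    : ℕ → ℚ
    cauchy : IsCauchy seq

open ℝ public

infix  4 _≃_ _≤ℝ_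
infixl 6 _+ℝ_ _-ℝ_
infixl 7 _*ℝ_
infix  8 -ℝ_

_≃_ : ℝ → ℝ → Set
x ≃ y = ∀ ε → 0ℚ ℚ.< ε → ∃[ N ] (∀ n → N ℕ.≤ n → ∣ seq x n ℚ.- seq y n ∣ ℚ.< ε)

_≤ℝ_ : ℝ → ℝ → Set
x ≤ℝ y = ∀ ε → 0ℚ ℚ.< ε → ∃[ N ] (∀ n → N ℕ.≤ n → seq x n ℚ.< seq y n ℚ.+ ε)

fromℚ : ℚ → ℝ
fromℚ q = mkℝ (λ _ → q) λ ε 0<ε → 0 , λ _ _ _ _ →
  subst (ℚ._< ε) (cong ∣_∣ (sym (ℚₚ.+-inverseʳ q))) 0<ε

fromℤ : ℤ → ℝ
fromℤ z = fromℚ (z ℚ./ 1)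

0ℝ : ℝ
0ℝ = fromℚ 0ℚ

_+ℝ_ : ℝ → ℝ → ℝ
seq    (x +ℝ y) n = seq x n ℚ.+ seq y n
cauchy (x +ℝ y) ε 0<ε with cauchy x (½ ℚ.* ε) (0<½* 0<ε) | cauchy y (½ ℚ.* ε) (0<½* 0<ε)
... | M , p | N , q = M ℕ.⊔ N , λ i j i≥ j≥ → begin-strict
    ∣ (seq x i ℚ.+ seq y i) ℚ.- (seq x j ℚ.+ seq y j) ∣
      ≡⟨ cong ∣_∣ (solve 4 (λ a b c d → (a :+ b) :- (c :+ d) := (a :- c) :+ (b :- d)) refl
                    (seq x i) (seq y i) (seq x j) (seq y j)) ⟩
    ∣ (seq x i ℚ.- seq x j) ℚ.+ (seq y i ℚ.- seq y j) ∣
      ≤⟨ ℚₚ.∣p+q∣≤∣p∣+∣q∣ (seq x i ℚ.- seq x j) (seq y i ℚ.- seq y j) ⟩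
    ∣ seq x i ℚ.- seq x j ∣ ℚ.+ ∣ seq y i ℚ.- seq y j ∣
      <⟨ ℚₚ.+-mono-<
           (p i j (ℕₚ.≤-trans (ℕₚ.m≤m⊔n M N) i≥) (ℕₚ.≤-trans (ℕₚ.m≤m⊔n M N) j≥))
           (q i j (ℕₚ.≤-trans (ℕₚ.m≤n⊔m M N) i≥) (ℕₚ.≤-trans (ℕₚ.m≤n⊔m M N) j≥)) ⟩
    ½ ℚ.* ε ℚ.+ ½ ℚ.* ε
      ≡⟨ ½+½ ε ⟩
    ε ∎
  where open ℚₚ.≤-Reasoning

-ℝ_ : ℝ → ℝ
seq    (-ℝ x) n = ℚ.- seq x n
cauchy (-ℝ x) ε 0<ε with cauchy x ε 0<ε
... | N , p = N , λ i j i≥ j≥ → subst (ℚ._< ε)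
  (cong ∣_∣ (solve 2 (λ a b → a :- b := (:- b) :- (:- a)) refl (seq x j) (seq x i)))
  (p j i j≥ i≥)

_-ℝ_ : ℝ → ℝ → ℝ
x -ℝ y = x +ℝ (-ℝ y)

eventually-bounded : ∀ x → ∃₂ λ B N → 0ℚ ℚ.< B × (∀ n → N ℕ.≤ n → ∣ seq x n ∣ ℚ.≤ B)
eventually-bounded x with cauchy x 1ℚ (ℚₚ.positive⁻¹ 1ℚ)
... | N , p = B , N , 0<B , λ n n≥ → begin
    ∣ seq x n ∣
      ≡⟨ cong ∣_∣ (solve 2 (λ a b → a := b :+ (a :- b)) refl (seq x n) (seq x N)) ⟩
    ∣ seq x N ℚ.+ (seq x n ℚ.- seq x N) ∣
      ≤⟨ ℚₚ.∣p+q∣≤∣p∣+∣q∣ (seq x N) (seq x n ℚ.- seq x N) ⟩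
    ∣ seq x N ∣ ℚ.+ ∣ seq x n ℚ.- seq x N ∣
      ≤⟨ ℚₚ.+-monoʳ-≤ ∣ seq x N ∣ (ℚₚ.<⇒≤ (p n N n≥ ℕₚ.≤-refl)) ⟩
    B ∎
  where
  open ℚₚ.≤-Reasoning
  B = ∣ seq x N ∣ ℚ.+ 1ℚ
  0<B : 0ℚ ℚ.< B
  0<B = ℚₚ.+-mono-≤-< (ℚₚ.0≤∣p∣ (seq x N)) (ℚₚ.positive⁻¹ 1ℚ)

∣*-*∣≤ : ∀ a b c d → ∣ a ℚ.* b ℚ.- c ℚ.* d ∣ ℚ.≤ ∣ a ∣ ℚ.* ∣ b ℚ.- d ∣ ℚ.+ ∣ d ∣ ℚ.* ∣ a ℚ.- c ∣
∣*-*∣≤ a b c d = begin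
  ∣ a ℚ.* b ℚ.- c ℚ.* d ∣
    ≡⟨ cong ∣_∣ (solve 4 (λ a b c d → a :* b :- c :* d := a :* (b :- d) :+ d :* (a :- c)) refl a b c d) ⟩
  ∣ a ℚ.* (b ℚ.- d) ℚ.+ d ℚ.* (a ℚ.- c) ∣
    ≤⟨ ℚₚ.∣p+q∣≤∣p∣+∣q∣ (a ℚ.* (b ℚ.- d)) (d ℚ.* (a ℚ.- c)) ⟩
  ∣ a ℚ.* (b ℚ.- d) ∣ ℚ.+ ∣ d ℚ.* (a ℚ.- c) ∣
    ≡⟨ cong₂ ℚ._+_ (ℚₚ.∣p*q∣≡∣p∣*∣q∣ a (b ℚ.- d)) (ℚₚ.∣p*q∣≡∣p∣*∣q∣ d (a ℚ.- c)) ⟩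
  ∣ a ∣ ℚ.* ∣ b ℚ.- d ∣ ℚ.+ ∣ d ∣ ℚ.* ∣ a ℚ.- c ∣ ∎
  where open ℚₚ.≤-Reasoning

modulus-* : ∀ B C ε → 0ℚ ℚ.< B → 0ℚ ℚ.< C → 0ℚ ℚ.< ε →
  ∃[ η ] 0ℚ ℚ.< η × B ℚ.* η ℚ.+ C ℚ.* η ℚ.< ε
modulus-* B C ε 0<B 0<C 0<ε = η , 0<η , subst (ℚ._< ε) (sym Bη+Cη≡½ε) (½*ε<ε 0<ε)
  where
  D = B ℚ.+ C
  instance
    D-pos : Positive D
    D-pos = ℚ.positive (ℚₚ.+-mono-< 0<B 0<C)
    D-nonZero : ℚ.NonZero D
    D-nonZero = ℚₚ.pos⇒nonZero D
  D⁻¹ = ℚ.1/ D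
  η = D⁻¹ ℚ.* (½ ℚ.* ε)
  0<η : 0ℚ ℚ.< η
  0<η = subst (ℚ._< η) (ℚₚ.*-zeroʳ D⁻¹)
    (ℚₚ.*-monoʳ-<-pos D⁻¹ {{ℚₚ.1/pos⇒pos D}} (0<½* 0<ε))
  Bη+Cη≡½ε : B ℚ.* η ℚ.+ C ℚ.* η ≡ ½ ℚ.* ε
  Bη+Cη≡½ε = begin
    B ℚ.* η ℚ.+ C ℚ.* η            ≡⟨ ℚₚ.*-distribʳ-+ η B C ⟨
    D ℚ.* (D⁻¹ ℚ.* (½ ℚ.* ε))      ≡⟨ ℚₚ.*-assoc D D⁻¹ (½ ℚ.* ε) ⟨
    (D ℚ.* D⁻¹) ℚ.* (½ ℚ.* ε)      ≡⟨ cong (ℚ._* (½ ℚ.* ε)) (ℚₚ.*-inverseʳ D) ⟩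
    1ℚ ℚ.* (½ ℚ.* ε)               ≡⟨ ℚₚ.*-identityˡ (½ ℚ.* ε) ⟩
    ½ ℚ.* ε                        ∎
    where open ≡-Reasoning

∣*-*∣< : ∀ a b c d B C η ε → 0ℚ ℚ.≤ B → 0ℚ ℚ.≤ C →
  ∣ a ∣ ℚ.≤ B → ∣ d ∣ ℚ.≤ C → ∣ a ℚ.- c ∣ ℚ.< η → ∣ b ℚ.- d ∣ ℚ.< η →
  B ℚ.* η ℚ.+ C ℚ.* η ℚ.< ε → ∣ a ℚ.* b ℚ.- c ℚ.* d ∣ ℚ.< ε
∣*-*∣< a b c d B C η ε 0≤B 0≤C a≤B d≤C a-c<η b-d<η <ε = ℚₚ.≤-<-trans
  (ℚₚ.≤-trans (∣*-*∣≤ a b c d) (ℚₚ.+-mono-≤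
    (*-mono-≤-nonNeg 0≤B (ℚₚ.0≤∣p∣ (b ℚ.- d)) a≤B (ℚₚ.<⇒≤ b-d<η))
    (*-mono-≤-nonNeg 0≤C (ℚₚ.0≤∣p∣ (a ℚ.- c)) d≤C (ℚₚ.<⇒≤ a-c<η))))
  <ε

_*ℝ_ : ℝ → ℝ → ℝ
seq    (x *ℝ y) n = seq x n ℚ.* seq y n
cauchy (x *ℝ y) ε 0<ε =
  let B , K , 0<B , x≤B = eventually-bounded x
      C , L , 0<C , y≤C = eventually-bounded y
      η , 0<η , Bη+Cη<ε = modulus-* B C ε 0<B 0<C 0<ε
      M , p = cauchy x η 0<η
      N , q = cauchy y η 0<η
  in (K ℕ.⊔ L) ℕ.⊔ (M ℕ.⊔ N) , λ i j i≥ j≥ →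
  let i≥KL = ℕₚ.m⊔n≤o⇒m≤o (K ℕ.⊔ L) (M ℕ.⊔ N) i≥
      i≥MN = ℕₚ.m⊔n≤o⇒n≤o (K ℕ.⊔ L) (M ℕ.⊔ N) i≥
      j≥KL = ℕₚ.m⊔n≤o⇒m≤o (K ℕ.⊔ L) (M ℕ.⊔ N) j≥
      j≥MN = ℕₚ.m⊔n≤o⇒n≤o (K ℕ.⊔ L) (M ℕ.⊔ N) j≥
  in ∣*-*∣< (seq x i) (seq y i) (seq x j) (seq y j) B C η ε
       (ℚₚ.<⇒≤ 0<B) (ℚₚ.<⇒≤ 0<C)
       (x≤B i (ℕₚ.m⊔n≤o⇒m≤o K L i≥KL)) (y≤C j (ℕₚ.m⊔n≤o⇒n≤o K L j≥KL))
       (p i j (ℕₚ.m⊔n≤o⇒m≤o M N i≥MN) (ℕₚ.m⊔n≤o⇒m≤o M N j≥MN))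
       (q i j (ℕₚ.m⊔n≤o⇒n≤o M N i≥MN) (ℕₚ.m⊔n≤o⇒n≤o M N j≥MN))
       Bη+Cη<ε

-- The largest of the multiples 0, δ, 2δ, …, kδ that can be reached without
-- passing the square root of q; it stays at 0 when q is negative.
climb : ℚ → ℚ → ℕ → ℚ
climb δ q zero = 0ℚ
climb δ q (suc k) with (climb δ q k ℚ.+ δ) ℚ.* (climb δ q k ℚ.+ δ) ℚₚ.≤? q
... | yes _ = climb δ q k ℚ.+ δ
... | no  _ = climb δ q k

climb-nonNeg : ∀ δ q k → 0ℚ ℚ.≤ δ → 0ℚ ℚ.≤ climb δ q k
climb-nonNeg δ q zero 0≤δ = ℚₚ.≤-refl
climb-nonNeg δ q (suc k) 0≤δ with (climb δ q k ℚ.+ δ) ℚ.* (climb δ q k ℚ.+ δ) ℚₚ.≤? q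
... | yes _ = ℚₚ.+-mono-≤ (climb-nonNeg δ q k 0≤δ) 0≤δ
... | no  _ = climb-nonNeg δ q k 0≤δ

climb-lower : ∀ δ q k → climb δ q k ≡ 0ℚ ⊎ climb δ q k ℚ.* climb δ q k ℚ.≤ q
climb-lower δ q zero = inj₁ refl
climb-lower δ q (suc k) with (climb δ q k ℚ.+ δ) ℚ.* (climb δ q k ℚ.+ δ) ℚₚ.≤? q
... | yes p = inj₂ p
... | no  _ = climb-lower δ q k

climb-upper : ∀ δ q k →
  q ℚ.< (climb δ q k ℚ.+ δ) ℚ.* (climb δ q k ℚ.+ δ) ⊎ fromℕ k ℚ.* δ ℚ.≤ climb δ q k
climb-upper δ q zero = inj₂ (ℚₚ.≤-reflexive (ℚₚ.*-zeroˡ δ))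
climb-upper δ q (suc k) with (climb δ q k ℚ.+ δ) ℚ.* (climb δ q k ℚ.+ δ) ℚₚ.≤? q
... | no ¬p = inj₁ (ℚₚ.≰⇒> ¬p)
... | yes p with climb-upper δ q k
...   | inj₁ q< = contradiction p (<⇒≱ q<)
...   | inj₂ kδ≤ = inj₂ (begin
  fromℕ (suc k) ℚ.* δ       ≡⟨ cong (ℚ._* δ) (fromℕ-suc k) ⟩
  (1ℚ ℚ.+ fromℕ k) ℚ.* δ    ≡⟨ solve 2 (λ k δ → (con 1ℚ :+ k) :* δ := k :* δ :+ δ) refl (fromℕ k) δ ⟩
  fromℕ k ℚ.* δ ℚ.+ δ       ≤⟨ ℚₚ.+-monoˡ-≤ δ kδ≤ ⟩
  climb δ q k ℚ.+ δ         ∎)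
  where open ℚₚ.≤-Reasoning

climb-bound : ∀ δ q k M → 0ℚ ℚ.≤ δ → fromℕ k ℚ.* δ ≡ M → 1ℚ ℚ.≤ M → q ℚ.< M →
  q ℚ.< (climb δ q k ℚ.+ δ) ℚ.* (climb δ q k ℚ.+ δ)
climb-bound δ q k M 0≤δ kδ≡M 1≤M q<M with climb-upper δ q k
... | inj₁ q< = q<
... | inj₂ kδ≤r = begin-strict
  q              <⟨ q<M ⟩
  M              ≡⟨ ℚₚ.*-identityˡ M ⟨
  1ℚ ℚ.* M       ≤⟨ *-mono-≤-nonNeg 0≤M 0≤M 1≤M ℚₚ.≤-refl ⟩
  M ℚ.* M        ≤⟨ *-mono-≤-nonNeg (ℚₚ.≤-trans 0≤M M≤r+δ) 0≤M M≤r+δ M≤r+δ ⟩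
  (climb δ q k ℚ.+ δ) ℚ.* (climb δ q k ℚ.+ δ) ∎
  where
  open ℚₚ.≤-Reasoning
  0≤M : 0ℚ ℚ.≤ M
  0≤M = ℚₚ.≤-trans (ℚₚ.nonNegative⁻¹ 1ℚ) 1≤M
  M≤r+δ : M ℚ.≤ climb δ q k ℚ.+ δ
  M≤r+δ = subst₂ ℚ._≤_ (trans (ℚₚ.+-identityʳ (fromℕ k ℚ.* δ)) kδ≡M) refl
    (ℚₚ.+-mono-≤ kδ≤r 0≤δ)

-- Opaque only to keep the type checker from unfolding it; use the three
-- properties below instead.
opaque
  -- The square root of max(q, 0), rounded down to a multiple of 1 / (n + 1).
  √-approx : ℕ → ℚ → ℚ
  √-approx n q = climb (step n) q (suc ℤ.∣ ℚ.↥ q ∣ ℕ.* suc n)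

  √-approx-nonNeg : ∀ n q → 0ℚ ℚ.≤ √-approx n q
  √-approx-nonNeg n q =
    climb-nonNeg (step n) q (suc ℤ.∣ ℚ.↥ q ∣ ℕ.* suc n) (ℚₚ.<⇒≤ (0<step n))

  √-approx-lower : ∀ n q → √-approx n q ≡ 0ℚ ⊎ √-approx n q ℚ.* √-approx n q ℚ.≤ q
  √-approx-lower n q = climb-lower (step n) q (suc ℤ.∣ ℚ.↥ q ∣ ℕ.* suc n)

  √-approx-upper : ∀ n q → q ℚ.< (√-approx n q ℚ.+ step n) ℚ.* (√-approx n q ℚ.+ step n)
  √-approx-upper n q = climb-bound (step n) q (suc a ℕ.* suc n) (fromℕ (suc a))
    (ℚₚ.<⇒≤ (0<step n)) kδ≡M 1≤M (ℚₚ.≤-<-trans (≤-fromℕ-numerator q) a<M)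
    where
    a : ℕ
    a = ℤ.∣ ℚ.↥ q ∣
    a<M : fromℕ a ℚ.< fromℕ (suc a)
    a<M = subst₂ ℚ._<_ (ℚₚ.+-identityˡ (fromℕ a)) (sym (fromℕ-suc a))
      (ℚₚ.+-monoˡ-< (fromℕ a) (ℚₚ.positive⁻¹ 1ℚ))
    1≤M : 1ℚ ℚ.≤ fromℕ (suc a)
    1≤M = subst₂ ℚ._≤_ (ℚₚ.+-identityʳ 1ℚ) (sym (fromℕ-suc a)) (ℚₚ.+-monoʳ-≤ 1ℚ (0≤fromℕ a))
    kδ≡M : fromℕ (suc a ℕ.* suc n) ℚ.* step n ≡ fromℕ (suc a)
    kδ≡M = trans (cong (ℚ._* step n) (fromℕ-* (suc a) (suc n)))
      (trans (ℚₚ.*-assoc (fromℕ (suc a)) (fromℕ (suc n)) (step n))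
      (trans (cong (fromℕ (suc a) ℚ.*_) (suc*step≡1 n)) (ℚₚ.*-identityʳ (fromℕ (suc a)))))

√-approx-close : ∀ i j p q ε → 0ℚ ℚ.< ε → step j ℚ.≤ ½ ℚ.* ε →
  ∣ p ℚ.- q ∣ ℚ.< (½ ℚ.* ε) ℚ.* (½ ℚ.* ε) → √-approx i p ℚ.< √-approx j q ℚ.+ ε
√-approx-close i j p q ε 0<ε δ≤h ∣p-q∣<h² = ℚₚ.≰⇒> absurd
  where
  open ℚₚ.≤-Reasoning
  h = ½ ℚ.* ε
  r = √-approx i p
  s = √-approx j q
  0≤s : 0ℚ ℚ.≤ s
  0≤s = √-approx-nonNeg j q
  0<h : 0ℚ ℚ.< h
  0<h = 0<½* 0<ε
  0<s+ε : 0ℚ ℚ.< s ℚ.+ ε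
  0<s+ε = ℚₚ.+-mono-≤-< 0≤s 0<ε
  0≤s+h : 0ℚ ℚ.≤ s ℚ.+ h
  0≤s+h = ℚₚ.+-mono-≤ 0≤s (ℚₚ.<⇒≤ 0<h)
  0≤s+δ : 0ℚ ℚ.≤ s ℚ.+ step j
  0≤s+δ = ℚₚ.+-mono-≤ 0≤s (ℚₚ.<⇒≤ (0<step j))
  s+δ≤s+h : s ℚ.+ step j ℚ.≤ s ℚ.+ h
  s+δ≤s+h = ℚₚ.+-monoʳ-≤ s δ≤h
  0≤extra : 0ℚ ℚ.≤ (s ℚ.+ h) ℚ.* h ℚ.+ (s ℚ.+ h) ℚ.* h
  0≤extra = ℚₚ.+-mono-≤ 0≤[s+h]h 0≤[s+h]h
    where 0≤[s+h]h = *-mono-≤-nonNeg 0≤s+h ℚₚ.≤-refl 0≤s+h (ℚₚ.<⇒≤ 0<h)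
  absurd : ¬ (s ℚ.+ ε ℚ.≤ r)
  absurd s+ε≤r with √-approx-lower i p
  ... | inj₁ r≡0 = <⇒≱ 0<s+ε (subst (s ℚ.+ ε ℚ.≤_) r≡0 s+ε≤r)
  ... | inj₂ r²≤p = ℚₚ.<-irrefl refl (begin-strict
    p                                                  <⟨ ∣p-q∣<ε⇒p<q+ε ∣p-q∣<h² ⟩
    q ℚ.+ h ℚ.* h                                      <⟨ ℚₚ.+-monoˡ-< (h ℚ.* h) (√-approx-upper j q) ⟩
    (s ℚ.+ step j) ℚ.* (s ℚ.+ step j) ℚ.+ h ℚ.* h      ≤⟨ ℚₚ.+-monoˡ-≤ (h ℚ.* h) (*-mono-≤-nonNeg 0≤s+h 0≤s+δ s+δ≤s+h s+δ≤s+h) ⟩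
    (s ℚ.+ h) ℚ.* (s ℚ.+ h) ℚ.+ h ℚ.* h                ≡⟨ ℚₚ.+-identityʳ _ ⟨
    (s ℚ.+ h) ℚ.* (s ℚ.+ h) ℚ.+ h ℚ.* h ℚ.+ 0ℚ         ≤⟨ ℚₚ.+-monoʳ-≤ ((s ℚ.+ h) ℚ.* (s ℚ.+ h) ℚ.+ h ℚ.* h) 0≤extra ⟩
    (s ℚ.+ h) ℚ.* (s ℚ.+ h) ℚ.+ h ℚ.* h ℚ.+ ((s ℚ.+ h) ℚ.* h ℚ.+ (s ℚ.+ h) ℚ.* h)
      ≡⟨ solve 2 (λ s h → (s :+ h) :* (s :+ h) :+ h :* h :+ ((s :+ h) :* h :+ (s :+ h) :* h)
                        := (s :+ (h :+ h)) :* (s :+ (h :+ h))) refl s h ⟩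
    (s ℚ.+ (h ℚ.+ h)) ℚ.* (s ℚ.+ (h ℚ.+ h))            ≡⟨ cong (λ e → (s ℚ.+ e) ℚ.* (s ℚ.+ e)) (½+½ ε) ⟩
    (s ℚ.+ ε) ℚ.* (s ℚ.+ ε)                            ≤⟨ *-mono-≤-nonNeg (ℚₚ.≤-trans (ℚₚ.<⇒≤ 0<s+ε) s+ε≤r) (ℚₚ.<⇒≤ 0<s+ε) s+ε≤r s+ε≤r ⟩
    r ℚ.* r                                            ≤⟨ r²≤p ⟩
    p                                                  ∎)

-- The square root of max(x, 0).
√_ : ℝ → ℝ
seq    (√ x) n = √-approx n (seq x n)
cauchy (√ x) ε 0<ε
  with cauchy x ((½ ℚ.* ε) ℚ.* (½ ℚ.* ε)) 0<h² | step-archimedean (½ ℚ.* ε) 0<h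
  where
  0<h : 0ℚ ℚ.< ½ ℚ.* ε
  0<h = 0<½* 0<ε
  0<h² : 0ℚ ℚ.< (½ ℚ.* ε) ℚ.* (½ ℚ.* ε)
  0<h² = subst (ℚ._< (½ ℚ.* ε) ℚ.* (½ ℚ.* ε)) (ℚₚ.*-zeroʳ (½ ℚ.* ε))
    (ℚₚ.*-monoʳ-<-pos (½ ℚ.* ε) {{ℚ.positive 0<h}} 0<h)
... | M , p | N , δ≤h = M ℕ.⊔ N , λ i j i≥ j≥ →
  let ≥M = λ {k} (h : M ℕ.⊔ N ℕ.≤ k) → ℕₚ.m⊔n≤o⇒m≤o M N h
      ≥N = λ {k} (h : M ℕ.⊔ N ℕ.≤ k) → ℕₚ.m⊔n≤o⇒n≤o M N h
  in ∣p-q∣<ε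
       (√-approx-close i j (seq x i) (seq x j) ε 0<ε (δ≤h j (≥N j≥)) (p i j (≥M i≥) (≥M j≥)))
       (√-approx-close j i (seq x j) (seq x i) ε 0<ε (δ≤h i (≥N i≥)) (p j i (≥M j≥) (≥M i≥)))

------------------------------------------------------------------------
-- Euclidean geometry

infix 7 _·_

Σℝ : ∀ {m} → Vector ℝ m → ℝ
Σℝ = foldr _+ℝ_ 0ℝ

_·_ : ∀ {m} → Vector ℝ m → Vector ℝ m → ℝ
p · q = Σℝ λ k → p k *ℝ q k

dist : ∀ {m} → Vector ℝ m → Vector ℝ m → ℝ
dist p q = √ (Σℝ λ k → (p k -ℝ q k) *ℝ (p k -ℝ q k))

IsInteger : ℝ → Set
IsInteger x = ∃[ z ] x ≃ fromℤ z

-- All points satisfy one linear equation a · x = b whose normal vector a is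
-- not zero.
InHyperplane : ∀ {m n} → (Fin n → Vector ℝ m) → Set
InHyperplane {m} P = Σ (Vector ℝ m) λ a → ∃[ b ] ¬ (∀ k → a k ≃ 0ℝ) × (∀ i → a · P i ≃ b)

-- An integral point set in ℝᵐ consisting of n points, which are numbered.
record IntegralPointSet (m n : ℕ) : Set where
  field
    point         : Fin n → Vector ℝ m
    distinct      : ∀ i j → (∀ k → point i k ≃ point j k) → i ≡ j
    integral      : ∀ i j → IsInteger (dist (point i) (point j))
    nondegenerate : ¬ InHyperplane point

open IntegralPointSet public

IsDiameter : ∀ {m n} → IntegralPointSet m n → ℝ → Set
IsDiameter P D =
  (∃₂ λ i j → dist (point P i) (point P j) ≃ D) ×
  (∀ i j → dist (point P i) (point P j) ≤ℝ D)

-- The relation d = d(m, n).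
IsMinimalDiameter : ℕ → ℕ → ℝ → Set
IsMinimalDiameter m n d =
  (Σ (IntegralPointSet m n) λ P → IsDiameter P d) ×
  (∀ (P : IntegralPointSet m n) D → IsDiameter P D → d ≤ℝ D)

{-# OPTIONS --safe #-}
module Submission where

-- Take m vectors v₁, …, vₘ of length 4 in ℝᵐ at pairwise distance 5, so that
-- vᵢ · vⱼ = 7/2 for i ≠ j. The squared distance between x vᵢ and y vⱼ is
-- 16 (x - y)² when i = j and 16 (x - y)² + 25 x y otherwise, whatever m is. For
-- x, y ∈ {0, -33, 12, 44, 63} all these numbers are squares, which yields the
-- origin and 4m further points, with diameter 4 (63 + 33) = 384.

open import Defs
open import Data.Nat.Base using (ℕ; _+_; _*_; _≤_)
open import Data.Integer.Base using (+_)
open import Data.Product.Base using (Σ; ∃-syntax; _×_)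
open import Relation.Nullary using (¬_)
open import Algebra.Bundles using (CommutativeRing)
import Algebra.Properties.CommutativeMonoid.Sum as CommutativeMonoidSum
import Algebra.Properties.Semiring.Sum as SemiringSum
open import Data.Bool.Base using (Bool; true; false; if_then_else_)
open import Data.Fin.Base using (Fin; zero; suc; splitAt; join; remQuot; combine)
import Data.Fin.Properties as Finₚ
import Data.Integer.Base as ℤ
open import Data.Nat.Base using (suc; z≤n; s≤s; _⊔_) renaming (_<_ to _<ᴺ_)
open import Data.Nat.Induction using (<-rec)
import Data.Nat.Properties as ℕₚ
open import Data.Product.Base using (_,_; uncurry)
open import Data.Rational.Base as ℚ using (ℚ; 0ℚ; 1ℚ; ½; ∣_∣)
import Data.Rational.Properties as ℚₚ
open import Data.Rational.Solver using (module +-*-Solver)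
import Data.Sum.Base as Sum
open import Data.Sum.Base using (_⊎_; inj₁; inj₂)
open import Data.Vec.Base using (Vec; []; _∷_; lookup)
open import Data.Vec.Functional using (Vector)
open import Function.Base using (_∘_)
open import Relation.Binary.PropositionalEquality
open import Relation.Nullary using (yes; no; contradiction)
open import Relation.Nullary.Decidable using (does; toWitness; dec-true; _→-dec_)

open +-*-Solver using (solve; _:=_; _:+_; _:*_; _:-_; :-_; con)

-- Equality of real numbers

≡⇒≃ : ∀ x y → (∀ n → seq x n ≡ seq y n) → x ≃ y
≡⇒≃ x y x≡y ε 0<ε = 0 , λ n _ → subst (ℚ._< ε)
  (cong ∣_∣ (trans (sym (ℚₚ.+-inverseʳ (seq y n))) (cong (ℚ._- seq y n) (sym (x≡y n))))) 0<ε

≃-refl : ∀ x → x ≃ x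
≃-refl x = ≡⇒≃ x x λ _ → refl

≃-sym : ∀ x y → x ≃ y → y ≃ x
≃-sym x y x≃y ε 0<ε with x≃y ε 0<ε
... | N , p = N , λ n N≤n → subst (ℚ._< ε) (∣p-q∣≡∣q-p∣ (seq x n) (seq y n)) (p n N≤n)

∣+∣<ε : ∀ p q ε → ∣ p ∣ ℚ.< ½ ℚ.* ε → ∣ q ∣ ℚ.< ½ ℚ.* ε → ∣ p ℚ.+ q ∣ ℚ.< ε
∣+∣<ε p q ε p< q< = ℚₚ.≤-<-trans (ℚₚ.∣p+q∣≤∣p∣+∣q∣ p q)
  (subst (∣ p ∣ ℚ.+ ∣ q ∣ ℚ.<_) (½+½ ε) (ℚₚ.+-mono-< p< q<))

≃-trans : ∀ x y z → x ≃ y → y ≃ z → x ≃ z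
≃-trans x y z x≃y y≃z ε 0<ε with x≃y (½ ℚ.* ε) (0<½* 0<ε) | y≃z (½ ℚ.* ε) (0<½* 0<ε)
... | M , p | N , q = M ⊔ N , λ n ≥ → subst (ℚ._< ε)
  (cong ∣_∣ (solve 3 (λ a b c → (a :- b) :+ (b :- c) := a :- c) refl (seq x n) (seq y n) (seq z n)))
  (∣+∣<ε (seq x n ℚ.- seq y n) (seq y n ℚ.- seq z n) ε
    (p n (ℕₚ.m⊔n≤o⇒m≤o M N ≥)) (q n (ℕₚ.m⊔n≤o⇒n≤o M N ≥)))

+ℝ-cong : ∀ x y u v → x ≃ y → u ≃ v → x +ℝ u ≃ y +ℝ v
+ℝ-cong x y u v x≃y u≃v ε 0<ε with x≃y (½ ℚ.* ε) (0<½* 0<ε) | u≃v (½ ℚ.* ε) (0<½* 0<ε)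
... | M , p | N , q = M ⊔ N , λ n ≥ → subst (ℚ._< ε)
  (cong ∣_∣ (solve 4 (λ a b c d → (a :- b) :+ (c :- d) := (a :+ c) :- (b :+ d)) refl
    (seq x n) (seq y n) (seq u n) (seq v n)))
  (∣+∣<ε (seq x n ℚ.- seq y n) (seq u n ℚ.- seq v n) ε
    (p n (ℕₚ.m⊔n≤o⇒m≤o M N ≥)) (q n (ℕₚ.m⊔n≤o⇒n≤o M N ≥)))

-ℝ-cong : ∀ x y → x ≃ y → -ℝ x ≃ -ℝ y
-ℝ-cong x y x≃y ε 0<ε with x≃y ε 0<ε
... | N , p = N , λ n N≤n → subst (ℚ._< ε)
  (trans (∣p-q∣≡∣q-p∣ (seq x n) (seq y n))
    (cong ∣_∣ (solve 2 (λ a b → b :- a := (:- a) :- (:- b)) refl (seq x n) (seq y n))))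
  (p n N≤n)

*ℝ-cong : ∀ x y u v → x ≃ y → u ≃ v → x *ℝ u ≃ y *ℝ v
*ℝ-cong x y u v x≃y u≃v ε 0<ε =
  let B , K , 0<B , x≤B = eventually-bounded x
      C , L , 0<C , v≤C = eventually-bounded v
      η , 0<η , Bη+Cη<ε = modulus-* B C ε 0<B 0<C 0<ε
      M , p = x≃y η 0<η
      N , q = u≃v η 0<η
  in (K ⊔ L) ⊔ (M ⊔ N) , λ n n≥ →
  let n≥KL = ℕₚ.m⊔n≤o⇒m≤o (K ⊔ L) (M ⊔ N) n≥
      n≥MN = ℕₚ.m⊔n≤o⇒n≤o (K ⊔ L) (M ⊔ N) n≥
  in ∣*-*∣< (seq x n) (seq u n) (seq y n) (seq v n) B C η ε
       (ℚₚ.<⇒≤ 0<B) (ℚₚ.<⇒≤ 0<C)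
       (x≤B n (ℕₚ.m⊔n≤o⇒m≤o K L n≥KL)) (v≤C n (ℕₚ.m⊔n≤o⇒n≤o K L n≥KL))
       (p n (ℕₚ.m⊔n≤o⇒m≤o M N n≥MN)) (q n (ℕₚ.m⊔n≤o⇒n≤o M N n≥MN))
       Bη+Cη<ε

Σℝ-cong : ∀ {m} (f g : Vector ℝ m) → (∀ k → f k ≃ g k) → Σℝ f ≃ Σℝ g
Σℝ-cong {ℕ.zero} f g f≃g = ≃-refl 0ℝ
Σℝ-cong {suc m}  f g f≃g =
  +ℝ-cong (f zero) (g zero) (Σℝ (f ∘ suc)) (Σℝ (g ∘ suc)) (f≃g zero) (Σℝ-cong (f ∘ suc) (g ∘ suc) (f≃g ∘ suc))

Σℝ-zero : ∀ {m} (f : Vector ℝ m) → (∀ k → f k ≃ 0ℝ) → Σℝ f ≃ 0ℝ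
Σℝ-zero {ℕ.zero} f f≃0 = ≃-refl 0ℝ
Σℝ-zero {suc m}  f f≃0 =
  +ℝ-cong (f zero) 0ℝ (Σℝ (f ∘ suc)) 0ℝ (f≃0 zero) (Σℝ-zero (f ∘ suc) (f≃0 ∘ suc))

≃⇒-ℝ≃0 : ∀ x y → x ≃ y → x -ℝ y ≃ 0ℝ
≃⇒-ℝ≃0 x y x≃y = ≃-trans (x -ℝ y) (y -ℝ y) 0ℝ
  (+ℝ-cong x y (-ℝ y) (-ℝ y) x≃y (≃-refl (-ℝ y)))
  (≡⇒≃ (y -ℝ y) 0ℝ λ n → ℚₚ.+-inverseʳ (seq y n))

-- The two constant sequences differ by |p - q| at every index, so for p ≠ q the choice ε = |p - q|
-- gives |p - q| < |p - q|.
fromℚ-injective : ∀ p q → fromℚ p ≃ fromℚ q → p ≡ q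
fromℚ-injective p q p≃q with p ℚₚ.≟ q
... | yes p≡q = p≡q
... | no  p≢q = contradiction (∣p-q∣< 0<∣p-q∣) (ℚₚ.<-irrefl refl)
  where
  0≢∣p-q∣ : 0ℚ ≢ ∣ p ℚ.- q ∣
  0≢∣p-q∣ 0≡ = p≢q (trans (solve 2 (λ p q → p := (p :- q) :+ q) refl p q)
    (trans (cong (ℚ._+ q) (ℚₚ.∣p∣≡0⇒p≡0 (p ℚ.- q) (sym 0≡))) (ℚₚ.+-identityˡ q)))
  0<∣p-q∣ : 0ℚ ℚ.< ∣ p ℚ.- q ∣
  0<∣p-q∣ = ℚₚ.≰⇒> λ ≤0 → 0≢∣p-q∣ (ℚₚ.≤-antisym (ℚₚ.0≤∣p∣ (p ℚ.- q)) ≤0)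
  ∣p-q∣< : ∀ {ε} → 0ℚ ℚ.< ε → ∣ p ℚ.- q ∣ ℚ.< ε
  ∣p-q∣< {ε} 0<ε with p≃q ε 0<ε
  ... | N , h = h N ℕₚ.≤-refl

*ℝ-zeroʳ : ∀ x y → y ≃ 0ℝ → x *ℝ y ≃ 0ℝ
*ℝ-zeroʳ x y y≃0 = ≃-trans (x *ℝ y) (x *ℝ 0ℝ) 0ℝ (*ℝ-cong x x y 0ℝ (≃-refl x) y≃0)
  (≡⇒≃ (x *ℝ 0ℝ) 0ℝ λ n → ℚₚ.*-zeroʳ (seq x n))

-- Square roots

square-mono-≤ : ∀ {p q} → 0ℚ ℚ.≤ p → p ℚ.≤ q → p ℚ.* p ℚ.≤ q ℚ.* q
square-mono-≤ 0≤p p≤q = *-mono-≤-nonNeg (ℚₚ.≤-trans 0≤p p≤q) 0≤p p≤q p≤q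

square-cancel-< : ∀ {p q} → 0ℚ ℚ.≤ q → p ℚ.* p ℚ.< q ℚ.* q → p ℚ.< q
square-cancel-< 0≤q p²<q² = ℚₚ.≰⇒> λ q≤p → <⇒≱ p²<q² (square-mono-≤ 0≤q q≤p)

square-mono-< : ∀ {p q} → 0ℚ ℚ.≤ p → p ℚ.< q → p ℚ.* p ℚ.< q ℚ.* q
square-mono-< {p} {q} 0≤p p<q = ℚₚ.≤-<-trans
  (*-mono-≤-nonNeg 0≤p 0≤p ℚₚ.≤-refl (ℚₚ.<⇒≤ p<q))
  (ℚₚ.*-monoˡ-<-pos q {{ℚ.positive (ℚₚ.≤-<-trans 0≤p p<q)}} p<q)

-- Radicands closer than (ε/2)² have rounded roots closer than ε, as soon as the rounding step 1/(n
-- + 1) is at most ε/2.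
√-cong : ∀ x y → x ≃ y → √ x ≃ √ y
√-cong x y x≃y ε 0<ε with x≃y ((½ ℚ.* ε) ℚ.* (½ ℚ.* ε)) 0<h² | step-archimedean (½ ℚ.* ε) (0<½* 0<ε)
  where
  0<h² : 0ℚ ℚ.< (½ ℚ.* ε) ℚ.* (½ ℚ.* ε)
  0<h² = subst (ℚ._< (½ ℚ.* ε) ℚ.* (½ ℚ.* ε)) (ℚₚ.*-zeroʳ (½ ℚ.* ε))
    (ℚₚ.*-monoʳ-<-pos (½ ℚ.* ε) {{ℚ.positive (0<½* 0<ε)}} (0<½* 0<ε))
... | M , p | N , δ≤h = M ⊔ N , λ n ≥ →
  let x-y< = p n (ℕₚ.m⊔n≤o⇒m≤o M N ≥)
      δ≤   = δ≤h n (ℕₚ.m⊔n≤o⇒n≤o M N ≥)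
      y-x< = subst (ℚ._< (½ ℚ.* ε) ℚ.* (½ ℚ.* ε)) (∣p-q∣≡∣q-p∣ (seq x n) (seq y n)) x-y<
  in ∣p-q∣<ε (√-approx-close n n (seq x n) (seq y n) ε 0<ε δ≤ x-y<)
             (√-approx-close n n (seq y n) (seq x n) ε 0<ε δ≤ y-x<)

-- The sign of q settles the case where the rounded root is 0, in which `√-approx-lower` gives no
-- bound.
√-approx² : ∀ n q → 0ℚ ℚ.≤ q → √-approx n q ℚ.* √-approx n q ℚ.≤ q
√-approx² n q 0≤q with √-approx-lower n q
... | inj₁ r≡0 = subst (λ r → r ℚ.* r ℚ.≤ q) (sym r≡0) 0≤q
... | inj₂ r²≤q = r²≤q

-- The rounded root r of d² satisfies r² ≤ d² < (r + 1/(n + 1))², hence r ≤ d < r + 1/(n + 1).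
√-of-square : ∀ d → 0ℚ ℚ.≤ d → √ (fromℚ (d ℚ.* d)) ≃ fromℚ d
√-of-square d 0≤d ε 0<ε with step-archimedean (½ ℚ.* ε) (0<½* 0<ε)
... | N , δ≤h = N , λ n N≤n →
  let r = √-approx n (d ℚ.* d)
      0≤r = √-approx-nonNeg n (d ℚ.* d)
      δ<ε = ℚₚ.≤-<-trans (δ≤h n N≤n) (½*ε<ε 0<ε)
      r≤d = ℚₚ.≮⇒≥ λ d<r → <⇒≱ (square-mono-< 0≤d d<r) (√-approx² n (d ℚ.* d) (0≤p*p d))
      d<r+δ = square-cancel-< (ℚₚ.+-mono-≤ 0≤r (ℚₚ.<⇒≤ (0<step n))) (√-approx-upper n (d ℚ.* d))
  in ∣p-q∣<ε {r} {d} (ℚₚ.≤-<-trans r≤d d<d+ε) (ℚₚ.<-trans d<r+δ (ℚₚ.+-monoʳ-< r δ<ε))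
  where
  d<d+ε : d ℚ.< d ℚ.+ ε
  d<d+ε = subst (ℚ._< d ℚ.+ ε) (ℚₚ.+-identityʳ d) (ℚₚ.+-monoʳ-< d 0<ε)

step≤1 : ∀ n → step n ℚ.≤ 1ℚ
step≤1 n = subst₂ ℚ._≤_ (ℚₚ.*-identityˡ (step n)) (suc*step≡1 n)
  (ℚₚ.*-monoʳ-≤-nonNeg (step n) {{ℚ.nonNegative (ℚₚ.<⇒≤ (0<step n))}} 1≤suc)
  where
  1≤suc : 1ℚ ℚ.≤ fromℕ (suc n)
  1≤suc = subst₂ ℚ._≤_ (ℚₚ.+-identityʳ 1ℚ) (sym (fromℕ-suc n)) (ℚₚ.+-monoʳ-≤ 1ℚ (0≤fromℕ n))

-- With δ = 1/(n + 1) the rounded root r satisfies r² ≤ q < r² + 2rδ + δ². The excess is at most 2Bη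
-- + η, where B bounds r and δ ≤ η, because δ² ≤ δ.
√-squared : ∀ q → 0ℚ ℚ.≤ q → √ (fromℚ q) *ℝ √ (fromℚ q) ≃ fromℚ q
√-squared q 0≤q ε 0<ε =
  let B , K , 0<B , r≤B = eventually-bounded (√ (fromℚ q))
      η , 0<η , [B+B]η+η<ε = modulus-* (B ℚ.+ B) 1ℚ ε (ℚₚ.+-mono-< 0<B 0<B) (ℚₚ.positive⁻¹ 1ℚ) 0<ε
      N , δ≤η = step-archimedean η 0<η
  in K ⊔ N , λ n n≥ →
  let r = √-approx n q
      δ = step n
      0≤r = √-approx-nonNeg n q
      0≤δ = ℚₚ.<⇒≤ (0<step n)
      δ≤η′ = δ≤η n (ℕₚ.m⊔n≤o⇒n≤o K N n≥)
      r≤B′ = ℚₚ.≤-trans (p≤∣p∣ r) (r≤B n (ℕₚ.m⊔n≤o⇒m≤o K N n≥))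
      extra : (r ℚ.+ r) ℚ.* δ ℚ.+ δ ℚ.* δ ℚ.< ε
      extra = ℚₚ.≤-<-trans (ℚₚ.+-mono-≤
        (*-mono-≤-nonNeg (ℚₚ.<⇒≤ (ℚₚ.+-mono-< 0<B 0<B)) 0≤δ (ℚₚ.+-mono-≤ r≤B′ r≤B′) δ≤η′)
        (*-mono-≤-nonNeg (ℚₚ.nonNegative⁻¹ 1ℚ) 0≤δ (step≤1 n) δ≤η′)) [B+B]η+η<ε
      q<r²+ε : q ℚ.< r ℚ.* r ℚ.+ ε
      q<r²+ε = ℚₚ.<-trans (√-approx-upper n q) (subst (ℚ._< r ℚ.* r ℚ.+ ε)
        (solve 2 (λ r δ → r :* r :+ ((r :+ r) :* δ :+ δ :* δ) := (r :+ δ) :* (r :+ δ)) refl r δ)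
        (ℚₚ.+-monoʳ-< (r ℚ.* r) extra))
      r²<q+ε : r ℚ.* r ℚ.< q ℚ.+ ε
      r²<q+ε = ℚₚ.≤-<-trans (√-approx² n q 0≤q)
        (subst (ℚ._< q ℚ.+ ε) (ℚₚ.+-identityʳ q) (ℚₚ.+-monoʳ-< q 0<ε))
  in ∣p-q∣<ε r²<q+ε q<r²+ε

fromℚ-*-cancel : ∀ q x .{{_ : ℚ.NonZero q}} → fromℚ q *ℝ x ≃ 0ℝ → x ≃ 0ℝ
fromℚ-*-cancel q x qx≃0 = ≃-trans x (q⁻¹ *ℝ (fromℚ q *ℝ x)) 0ℝ
  (≡⇒≃ x (q⁻¹ *ℝ (fromℚ q *ℝ x)) λ n → sym (trans (sym (ℚₚ.*-assoc (ℚ.1/ q) q (seq x n)))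
    (trans (cong (ℚ._* seq x n) (ℚₚ.*-inverseˡ q)) (ℚₚ.*-identityˡ (seq x n)))))
  (*ℝ-zeroʳ q⁻¹ (fromℚ q *ℝ x) qx≃0)
  where q⁻¹ = fromℚ (ℚ.1/ q)

-- Multiplying once more by √q turns the factor into the positive rational q, which has a rational
-- inverse.
√-*-cancel : ∀ q x → 0ℚ ℚ.< q → √ (fromℚ q) *ℝ x ≃ 0ℝ → x ≃ 0ℝ
√-*-cancel q x 0<q sx≃0 = fromℚ-*-cancel q x {{ℚₚ.pos⇒nonZero q {{ℚ.positive 0<q}}}}
  (≃-trans (fromℚ q *ℝ x) ((s *ℝ s) *ℝ x) 0ℝ
    (*ℝ-cong (fromℚ q) (s *ℝ s) x x (≃-sym (s *ℝ s) (fromℚ q) (√-squared q (ℚₚ.<⇒≤ 0<q))) (≃-refl x))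
    (≃-trans ((s *ℝ s) *ℝ x) (s *ℝ (s *ℝ x)) 0ℝ
      (≡⇒≃ ((s *ℝ s) *ℝ x) (s *ℝ (s *ℝ x)) λ n → ℚₚ.*-assoc (seq s n) (seq s n) (seq x n))
      (*ℝ-zeroʳ s (s *ℝ x) sx≃0)))
  where s = √ (fromℚ q)

-- The rays of the cone

open CommutativeMonoidSum (CommutativeRing.+-commutativeMonoid ℚₚ.+-*-commutativeRing)
  using (sum; ∑-distrib-+; sum-cong-≗)
open SemiringSum (CommutativeRing.semiring ℚₚ.+-*-commutativeRing) using (*-distribˡ-sum)

-- Reduces an identity between real sums to a rational identity at each index n.
seq-Σℝ : ∀ {m} (f : Vector ℝ m) n → seq (Σℝ f) n ≡ sum (λ k → seq (f k) n)
seq-Σℝ {ℕ.zero} f n = refl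
seq-Σℝ {suc m}  f n = cong (seq (f zero) n ℚ.+_) (seq-Σℝ (f ∘ suc) n)

sum-const : ∀ m c → sum {m} (λ _ → c) ≡ fromℕ m ℚ.* c
sum-const ℕ.zero  c = sym (ℚₚ.*-zeroˡ c)
sum-const (suc m) c = begin
  c ℚ.+ sum {m} (λ _ → c)    ≡⟨ cong (c ℚ.+_) (sum-const m c) ⟩
  c ℚ.+ fromℕ m ℚ.* c        ≡⟨ solve 2 (λ c m → c :+ m :* c := (con 1ℚ :+ m) :* c) refl c (fromℕ m) ⟩
  (1ℚ ℚ.+ fromℕ m) ℚ.* c     ≡⟨ cong (ℚ._* c) (fromℕ-suc m) ⟨
  fromℕ (suc m) ℚ.* c        ∎
  where open ≡-Reasoning

-- The Kronecker delta. It branches on the same Boolean that `labelDistance` hands to `distance`, so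
-- `distance-correct` applies to it directly.
δ : ∀ {m} → Fin m → Fin m → ℚ
δ a k = if does (a Finₚ.≟ k) then 1ℚ else 0ℚ

δ-refl : ∀ {m} (a : Fin m) → δ a a ≡ 1ℚ
δ-refl a = cong (if_then 1ℚ else 0ℚ) (dec-true (a Finₚ.≟ a) refl)

sum-δ : ∀ {m} (a : Fin m) (f : Vector ℚ m) → sum (λ k → δ a k ℚ.* f k) ≡ f a
sum-δ {suc m} zero f = begin
  1ℚ ℚ.* f zero ℚ.+ sum (λ k → 0ℚ ℚ.* f (suc k))
    ≡⟨ cong₂ ℚ._+_ (ℚₚ.*-identityˡ (f zero)) (sym (*-distribˡ-sum 0ℚ (f ∘ suc))) ⟩
  f zero ℚ.+ 0ℚ ℚ.* sum (f ∘ suc)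
    ≡⟨ cong (f zero ℚ.+_) (ℚₚ.*-zeroˡ (sum (f ∘ suc))) ⟩
  f zero ℚ.+ 0ℚ
    ≡⟨ ℚₚ.+-identityʳ (f zero) ⟩
  f zero ∎
  where open ≡-Reasoning
sum-δ {suc m} (suc a) f = begin
  0ℚ ℚ.* f zero ℚ.+ sum (λ k → δ a k ℚ.* f (suc k))
    ≡⟨ cong₂ ℚ._+_ (ℚₚ.*-zeroˡ (f zero)) (sum-δ a (f ∘ suc)) ⟩
  0ℚ ℚ.+ f (suc a)
    ≡⟨ ℚₚ.+-identityˡ (f (suc a)) ⟩
  f (suc a) ∎
  where open ≡-Reasoning

sum-δ-δ-const : ∀ {m} (a b : Fin m) (f g : Vector ℚ m) c →
  sum (λ k → δ a k ℚ.* f k ℚ.+ (δ b k ℚ.* g k ℚ.+ c)) ≡ f a ℚ.+ (g b ℚ.+ fromℕ m ℚ.* c)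
sum-δ-δ-const {m} a b f g c = trans
  (∑-distrib-+ (λ k → δ a k ℚ.* f k) (λ k → δ b k ℚ.* g k ℚ.+ c))
  (cong₂ ℚ._+_ (sum-δ a f)
    (trans (∑-distrib-+ (λ k → δ b k ℚ.* g k) (λ _ → c)) (cong₂ ℚ._+_ (sum-δ b g) (sum-const m c))))

-- The right side is `raySqDist` with p = α² and r = 2αβ + mβ², the inner product of two different
-- vectors αeᵢ + β(1, ..., 1).
sum-sq-diff : ∀ {m} α β x y (a b : Fin m) →
  sum (λ k → (x ℚ.* (α ℚ.* δ a k ℚ.+ β) ℚ.- y ℚ.* (α ℚ.* δ b k ℚ.+ β))
       ℚ.* (x ℚ.* (α ℚ.* δ a k ℚ.+ β) ℚ.- y ℚ.* (α ℚ.* δ b k ℚ.+ β))) ≡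
  (x ℚ.* x ℚ.+ y ℚ.* y ℚ.- (x ℚ.* y ℚ.+ x ℚ.* y) ℚ.* δ a b) ℚ.* (α ℚ.* α)
    ℚ.+ ((x ℚ.- y) ℚ.* (x ℚ.- y)) ℚ.* ((α ℚ.+ α) ℚ.* β ℚ.+ fromℕ m ℚ.* (β ℚ.* β))
sum-sq-diff {m} α β x y a b = begin
  sum sq
    -- One factor of each product of deltas stays inside `f` or `g`. Summation then evaluates `f` at
    -- a and `g` at b, which leaves `δ a a`, `δ b b` and the cross term `δ a b`.
    ≡⟨ sum-cong-≗ {m} {sq} {λ k → δ a k ℚ.* f k ℚ.+ (δ b k ℚ.* g k ℚ.+ c)} (λ k → solve 6 (λ α β x y d e →
         (x :* (α :* d :+ β) :- y :* (α :* e :+ β)) :* (x :* (α :* d :+ β) :- y :* (α :* e :+ β)) :=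
         d :* (x :* x :* α :* α :* d :+ (x :- y) :* (x :+ x) :* α :* β)
         :+ (e :* (y :* y :* α :* α :* e :- (x :* y :+ x :* y) :* α :* α :* d :- (x :- y) :* (y :+ y) :* α :* β)
         :+ (x :- y) :* (x :- y) :* β :* β)) refl α β x y (δ a k) (δ b k)) ⟩
  sum (λ k → δ a k ℚ.* f k ℚ.+ (δ b k ℚ.* g k ℚ.+ c))
    ≡⟨ sum-δ-δ-const a b f g c ⟩
  f a ℚ.+ (g b ℚ.+ fromℕ m ℚ.* c)
    ≡⟨ cong₂ (λ d e →
         (x ℚ.* x ℚ.* α ℚ.* α ℚ.* d ℚ.+ (x ℚ.- y) ℚ.* (x ℚ.+ x) ℚ.* α ℚ.* β) ℚ.+
         ((y ℚ.* y ℚ.* α ℚ.* α ℚ.* e ℚ.- (x ℚ.* y ℚ.+ x ℚ.* y) ℚ.* α ℚ.* α ℚ.* δ a b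
            ℚ.- (x ℚ.- y) ℚ.* (y ℚ.+ y) ℚ.* α ℚ.* β) ℚ.+ fromℕ m ℚ.* c)) (δ-refl a) (δ-refl b) ⟩
  _
    ≡⟨ solve 6 (λ α β x y d M →
         (x :* x :* α :* α :* con 1ℚ :+ (x :- y) :* (x :+ x) :* α :* β)
         :+ ((y :* y :* α :* α :* con 1ℚ :- (x :* y :+ x :* y) :* α :* α :* d :- (x :- y) :* (y :+ y) :* α :* β)
         :+ M :* ((x :- y) :* (x :- y) :* β :* β)) :=
         (x :* x :+ y :* y :- (x :* y :+ x :* y) :* d) :* (α :* α)
         :+ ((x :- y) :* (x :- y)) :* ((α :+ α) :* β :+ M :* (β :* β))) refl α β x y (δ a b) (fromℕ m) ⟩
  _ ∎
  where
  open ≡-Reasoning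
  f g sq : Vector ℚ m
  sq k = (x ℚ.* (α ℚ.* δ a k ℚ.+ β) ℚ.- y ℚ.* (α ℚ.* δ b k ℚ.+ β))
       ℚ.* (x ℚ.* (α ℚ.* δ a k ℚ.+ β) ℚ.- y ℚ.* (α ℚ.* δ b k ℚ.+ β))
  f k = x ℚ.* x ℚ.* α ℚ.* α ℚ.* δ a k ℚ.+ (x ℚ.- y) ℚ.* (x ℚ.+ x) ℚ.* α ℚ.* β
  g k = y ℚ.* y ℚ.* α ℚ.* α ℚ.* δ b k ℚ.- (x ℚ.* y ℚ.+ x ℚ.* y) ℚ.* α ℚ.* α ℚ.* δ a k
          ℚ.- (x ℚ.- y) ℚ.* (y ℚ.+ y) ℚ.* α ℚ.* β
  c : ℚ
  c = (x ℚ.- y) ℚ.* (x ℚ.- y) ℚ.* β ℚ.* β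

-- Turns a hyperplane equation at a ray point into one that involves only a single coordinate of the
-- normal vector and its coordinate sum.
sum-*-ray : ∀ {m} α β x (a : Vector ℚ m) i →
  sum (λ k → a k ℚ.* (x ℚ.* (α ℚ.* δ i k ℚ.+ β))) ≡ x ℚ.* (α ℚ.* a i ℚ.+ β ℚ.* sum a)
sum-*-ray {m} α β x a i = begin
  sum (λ k → a k ℚ.* (x ℚ.* (α ℚ.* δ i k ℚ.+ β)))
    ≡⟨ sum-cong-≗ {m} {λ k → a k ℚ.* (x ℚ.* (α ℚ.* δ i k ℚ.+ β))}
         {λ k → δ i k ℚ.* (x ℚ.* α ℚ.* a k) ℚ.+ (x ℚ.* β) ℚ.* a k} (λ k →
         solve 5 (λ a x α β d → a :* (x :* (α :* d :+ β)) := d :* (x :* α :* a) :+ (x :* β) :* a)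
           refl (a k) x α β (δ i k)) ⟩
  sum (λ k → δ i k ℚ.* (x ℚ.* α ℚ.* a k) ℚ.+ (x ℚ.* β) ℚ.* a k)
    ≡⟨ ∑-distrib-+ (λ k → δ i k ℚ.* (x ℚ.* α ℚ.* a k)) (λ k → (x ℚ.* β) ℚ.* a k) ⟩
  sum (λ k → δ i k ℚ.* (x ℚ.* α ℚ.* a k)) ℚ.+ sum (λ k → (x ℚ.* β) ℚ.* a k)
    ≡⟨ cong₂ ℚ._+_ (sum-δ i (λ k → x ℚ.* α ℚ.* a k)) (sym (*-distribˡ-sum (x ℚ.* β) a)) ⟩
  x ℚ.* α ℚ.* a i ℚ.+ (x ℚ.* β) ℚ.* sum a
    ≡⟨ solve 5 (λ x α β c A → x :* α :* c :+ (x :* β) :* A := x :* (α :* c :+ β :* A))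
         refl x α β (a i) (sum a) ⟩
  x ℚ.* (α ℚ.* a i ℚ.+ β ℚ.* sum a) ∎
  where open ≡-Reasoning

-- The squared distance between x v and y w, where v = w if d = 1 and v ≠ w if
-- d = 0, for vectors of squared norm p + r with pairwise inner product r.
raySqDist : (p r x y d : ℚ) → ℚ
raySqDist p r x y d =
  (x ℚ.* x ℚ.+ y ℚ.* y ℚ.- (x ℚ.* y ℚ.+ x ℚ.* y) ℚ.* d) ℚ.* p ℚ.+ ((x ℚ.- y) ℚ.* (x ℚ.- y)) ℚ.* r

-- Order and minima

≃⇒≤ℝ : ∀ x y → x ≃ y → x ≤ℝ y
≃⇒≤ℝ x y x≃y ε 0<ε with x≃y ε 0<ε
... | N , p = N , λ n N≤n → ∣p-q∣<ε⇒p<q+ε (p n N≤n)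

≤ℝ-trans : ∀ x y z → x ≤ℝ y → y ≤ℝ z → x ≤ℝ z
≤ℝ-trans x y z x≤y y≤z ε 0<ε with x≤y (½ ℚ.* ε) (0<½* 0<ε) | y≤z (½ ℚ.* ε) (0<½* 0<ε)
... | M , p | N , q = M ⊔ N , λ n ≥ → subst (seq x n ℚ.<_)
  (trans (ℚₚ.+-assoc (seq z n) (½ ℚ.* ε) (½ ℚ.* ε)) (cong (seq z n ℚ.+_) (½+½ ε)))
  (ℚₚ.<-trans (p n (ℕₚ.m⊔n≤o⇒m≤o M N ≥)) (ℚₚ.+-monoˡ-< (½ ℚ.* ε) (q n (ℕₚ.m⊔n≤o⇒n≤o M N ≥))))

fromℚ-mono-≤ : ∀ p q → p ℚ.≤ q → fromℚ p ≤ℝ fromℚ q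
fromℚ-mono-≤ p q p≤q ε 0<ε = 0 , λ _ _ →
  subst (ℚ._< q ℚ.+ ε) (ℚₚ.+-identityʳ p) (ℚₚ.+-mono-≤-< p≤q 0<ε)

fromℕ-mono-≤ : ∀ {a b} → a ≤ b → fromℕ a ℚ.≤ fromℕ b
fromℕ-mono-≤ {b = b} z≤n = 0≤fromℕ b
fromℕ-mono-≤ {suc a} {suc b} (s≤s a≤b) =
  subst₂ ℚ._≤_ (sym (fromℕ-suc a)) (sym (fromℕ-suc b)) (ℚₚ.+-monoʳ-≤ 1ℚ (fromℕ-mono-≤ a≤b))

fromℤ-mono-≤ : ∀ {a b} → a ≤ b → fromℤ (+ a) ≤ℝ fromℤ (+ b)
fromℤ-mono-≤ {a} {b} a≤b = fromℚ-mono-≤ (fromℕ a) (fromℕ b) (fromℕ-mono-≤ a≤b)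

-- If the root were -q with q = n + 1, the tolerance q would force some approximant below -q + q =
-- 0.
√-integer⇒natural : ∀ x → IsInteger (√ x) → ∃[ n ] √ x ≃ fromℤ (+ n)
√-integer⇒natural x (+ n , √x≃n) = n , √x≃n
√-integer⇒natural x (ℤ.-[1+ n ] , √x≃-q) with √x≃-q q 0<q
  where
  q : ℚ
  q = fromℕ (suc n)
  0<q : 0ℚ ℚ.< q
  0<q = ℚₚ.positive⁻¹ q {{ℚₚ.normalize-pos (suc n) 1}}
... | N , h = contradiction (√-approx-nonNeg N (seq x N)) (<⇒≱ (subst (√-approx N (seq x N) ℚ.<_)
  (ℚₚ.+-inverseˡ (fromℕ (suc n))) (∣p-q∣<ε⇒p<q+ε (h N ℕₚ.≤-refl))))

IsDiameter-resp-≃ : ∀ {m n} (P : IntegralPointSet m n) D E → D ≃ E → IsDiameter P D → IsDiameter P E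
IsDiameter-resp-≃ P D E D≃E ((i , j , attained) , bound) =
  (i , j , ≃-trans (dist (point P i) (point P j)) D E attained D≃E) ,
  λ i j → ≤ℝ-trans (dist (point P i) (point P j)) D E (bound i j) (≃⇒≤ℝ D E D≃E)

-- A diameter is attained by a pair of points, hence is one of the integral distances.
diameter-natural : ∀ {m n} (P : IntegralPointSet m n) D → IsDiameter P D → ∃[ d ] D ≃ fromℤ (+ d)
diameter-natural P D ((i , j , attained) , _) =
  let d , dist≃d = √-integer⇒natural (Σℝ λ k → (point P i k -ℝ point P j k) *ℝ (point P i k -ℝ point P j k))
                     (integral P i j)
  in d , ≃-trans D (dist (point P i) (point P j)) (fromℤ (+ d))
           (≃-sym (dist (point P i) (point P j)) D attained) dist≃d

integralPointSetOfDiameter : ∀ {m n} (P : Fin n → Vector ℝ m) (d : Fin n → Fin n → ℕ) →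
  (∀ i j → dist (P i) (P j) ≃ fromℤ (+ d i j)) →
  (∀ i j → (∀ k → P i k ≃ P j k) → i ≡ j) → ¬ InHyperplane P →
  ∀ D i j → d i j ≡ D → (∀ i j → d i j ≤ D) →
  Σ (IntegralPointSet m n) λ R → IsDiameter R (fromℤ (+ D))
integralPointSetOfDiameter P d dist≃d distinct nondegenerate D i j attained bound =
  record
    { point         = P
    ; distinct      = distinct
    ; integral      = λ i j → + d i j , dist≃d i j
    ; nondegenerate = nondegenerate
    } ,
  (i , j , subst (λ e → dist (P i) (P j) ≃ fromℤ (+ e)) attained (dist≃d i j)) ,
  λ i j → ≤ℝ-trans (dist (P i) (P j)) (fromℤ (+ d i j)) (fromℤ (+ D))
    (≃⇒≤ℝ (dist (P i) (P j)) (fromℤ (+ d i j)) (dist≃d i j)) (fromℤ-mono-≤ (bound i j))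

-- If no element were least, strong induction would refute `Q` everywhere. Without a decision
-- procedure for `Q` this argument gives the least element under a double negation.
¬¬-least : ∀ {ℓ} (Q : ℕ → Set ℓ) n → Q n → ¬ ¬ (∃[ d ] Q d × (∀ k → Q k → d ≤ k))
¬¬-least Q n Qn noLeast = <-rec (λ k → ¬ Q k) none n Qn
  where
  none : ∀ k → (∀ {j} → j <ᴺ k → ¬ Q j) → ¬ Q k
  none k below Qk = noLeast (k , Qk , λ j Qj → ℕₚ.≮⇒≥ λ j<k → below j<k Qj)

-- All diameters are natural numbers up to `≃`, so the least natural diameter is also least among
-- the real ones.
minimalDiameter≤ : ∀ {m n} a b → a ≤ b →
  (Σ (IntegralPointSet m n) λ P → IsDiameter P (fromℤ (+ a))) →
  ¬ ¬ (∃[ d ] IsMinimalDiameter m n d × d ≤ℝ fromℤ (+ b))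
minimalDiameter≤ {m} {n} a b a≤b exists none =
  ¬¬-least (λ d → Σ (IntegralPointSet m n) λ P → IsDiameter P (fromℤ (+ d))) a exists
    λ (d , attained , least) → none (fromℤ (+ d) , (attained , λ R D diam →
      let e , D≃e = diameter-natural R D diam
      in ≤ℝ-trans (fromℤ (+ d)) (fromℤ (+ e)) D
           (fromℤ-mono-≤ (least e (R , IsDiameter-resp-≃ R D (fromℤ (+ e)) D≃e diam)))
           (≃⇒≤ℝ (fromℤ (+ e)) D (≃-sym D (fromℤ (+ e)) D≃e))) ,
      fromℤ-mono-≤ (ℕₚ.≤-trans (least a exists) a≤b))

-- The point set below the bound is explicit; the double negation concerns only the existence of the
-- exact minimum.
diameterBounds : ∀ {m n} a b → a ≤ b →
  (Σ (IntegralPointSet m n) λ P → IsDiameter P (fromℤ (+ a))) →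
  (Σ (IntegralPointSet m n) λ P → ∃[ D ] IsDiameter P D × D ≤ℝ fromℤ (+ b)) ×
  ¬ ¬ (∃[ d ] IsMinimalDiameter m n d × d ≤ℝ fromℤ (+ b))
diameterBounds a b a≤b exists@(P , diam) =
  (P , fromℤ (+ a) , diam , fromℤ-mono-≤ a≤b) , minimalDiameter≤ a b a≤b exists

-- The point set

-- `inj₁ (s , k)` stands for scale index `suc s` on ray k, and `inj₂` for the origin, which is
-- shared by all rays and counted once.
Label : ℕ → Set
Label m = Fin 4 × Fin m ⊎ Fin 1

scaleIndex : ∀ {m} → Label m → Fin 5
scaleIndex (inj₁ (s , _)) = suc s
scaleIndex (inj₂ _)       = zero

label : ∀ m → Fin (4 * m + 1) → Label m
label m = Sum.map₁ (remQuot m) ∘ splitAt (4 * m)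

unlabel : ∀ m → Label m → Fin (4 * m + 1)
unlabel m = join (4 * m) 1 ∘ Sum.map₁ (uncurry (combine {4}))

unlabel-label : ∀ m i → unlabel m (label m i) ≡ i
unlabel-label m i = trans (cong (join (4 * m) 1) (lemma (splitAt (4 * m) i))) (Finₚ.join-splitAt (4 * m) 1 i)
  where
  lemma : ∀ j → Sum.map₁ (uncurry (combine {4})) (Sum.map₁ (remQuot m) j) ≡ j
  lemma (inj₁ j) = cong inj₁ (Finₚ.combine-remQuot {4} m j)
  lemma (inj₂ j) = refl

label-unlabel : ∀ m a → label m (unlabel m a) ≡ a
label-unlabel m (inj₁ (s , k)) = trans
  (cong (Sum.map₁ (remQuot {4} m)) (Finₚ.splitAt-join (4 * m) 1 (inj₁ (combine s k))))
  (cong inj₁ (Finₚ.remQuot-combine s k))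
label-unlabel m (inj₂ j) = cong (Sum.map₁ (remQuot {4} m)) (Finₚ.splitAt-join (4 * m) 1 (inj₂ j))

fromℕ-square≡0 : ∀ n → fromℕ n ℚ.* fromℕ n ≡ 0ℚ → n ≡ 0
fromℕ-square≡0 ℕ.zero  _ = refl
fromℕ-square≡0 (suc n) eq = contradiction
  (subst (0ℚ ℚ.<_) eq (square-mono-< {0ℚ} ℚₚ.≤-refl (ℚₚ.positive⁻¹ (fromℕ (suc n)) {{ℚₚ.normalize-pos (suc n) 1}})))
  (ℚₚ.<-irrefl refl)

-- The rays are spanned by the vectors α eᵢ + β (1, …, 1), where α and β are
-- chosen such that these vectors have pairwise inner product r and squared
-- norm p + r. For this, γ = α + m β has to satisfy γ² = p + m r.
module Rays (m : ℕ) (m⁻¹ : ℚ) (m*m⁻¹≡1 : fromℕ m ℚ.* m⁻¹ ≡ 1ℚ)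
            (p r : ℚ) (0<p : 0ℚ ℚ.< p) (0≤r : 0ℚ ℚ.≤ r) where

  -- The m spanning vectors add up to γ(1, ..., 1), whose squared norm mγ² has to equal m(p + r) +
  -- m(m - 1)r.
  γ² : ℚ
  γ² = p ℚ.+ fromℕ m ℚ.* r

  0<γ² : 0ℚ ℚ.< γ²
  0<γ² = ℚₚ.+-mono-<-≤ 0<p
    (*-mono-≤-nonNeg (0≤fromℕ m) ℚₚ.≤-refl (0≤fromℕ m) 0≤r)

  α γ β : ℝ
  α = √ (fromℚ p)
  γ = √ (fromℚ γ²)
  β = fromℚ m⁻¹ *ℝ (γ -ℝ α)

  α+mβ≡γ : ∀ n → seq α n ℚ.+ fromℕ m ℚ.* seq β n ≡ seq γ n
  α+mβ≡γ n = begin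
    seq α n ℚ.+ fromℕ m ℚ.* (m⁻¹ ℚ.* (seq γ n ℚ.- seq α n))
      ≡⟨ solve 4 (λ α M s γ → α :+ M :* (s :* (γ :- α)) := α :+ (M :* s) :* (γ :- α))
           refl (seq α n) (fromℕ m) m⁻¹ (seq γ n) ⟩
    seq α n ℚ.+ (fromℕ m ℚ.* m⁻¹) ℚ.* (seq γ n ℚ.- seq α n)
      ≡⟨ cong (λ c → seq α n ℚ.+ c ℚ.* (seq γ n ℚ.- seq α n)) m*m⁻¹≡1 ⟩
    seq α n ℚ.+ 1ℚ ℚ.* (seq γ n ℚ.- seq α n)
      ≡⟨ solve 2 (λ α γ → α :+ con 1ℚ :* (γ :- α) := γ) refl (seq α n) (seq γ n) ⟩
    seq γ n ∎
    where open ≡-Reasoning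

  -- The inner product of two different spanning vectors.
  inner : ℝ
  inner = (α +ℝ α) *ℝ β +ℝ fromℚ (fromℕ m) *ℝ (β *ℝ β)

  -- `inner` equals β(γ + α) = m⁻¹(γ² - α²), and γ² - α² = mr.
  inner≃r : inner ≃ fromℚ r
  inner≃r = ≃-trans inner s[γγ-αα] (fromℚ r) (≡⇒≃ inner s[γγ-αα] lemma)
    (≃-trans s[γγ-αα] (fromℚ m⁻¹ *ℝ (fromℚ γ² -ℝ fromℚ p)) (fromℚ r)
      (*ℝ-cong (fromℚ m⁻¹) (fromℚ m⁻¹) (γ *ℝ γ -ℝ α *ℝ α) (fromℚ γ² -ℝ fromℚ p)
        (≃-refl (fromℚ m⁻¹))
        (+ℝ-cong (γ *ℝ γ) (fromℚ γ²) (-ℝ (α *ℝ α)) (-ℝ fromℚ p) (√-squared γ² (ℚₚ.<⇒≤ 0<γ²))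
          (-ℝ-cong (α *ℝ α) (fromℚ p) (√-squared p (ℚₚ.<⇒≤ 0<p)))))
      (≡⇒≃ (fromℚ m⁻¹ *ℝ (fromℚ γ² -ℝ fromℚ p)) (fromℚ r) λ _ → trans
        (solve 4 (λ s p M r → s :* ((p :+ M :* r) :- p) := (M :* s) :* r) refl m⁻¹ p (fromℕ m) r)
        (trans (cong (ℚ._* r) m*m⁻¹≡1) (ℚₚ.*-identityˡ r))))
    where
    s[γγ-αα] : ℝ
    s[γγ-αα] = fromℚ m⁻¹ *ℝ (γ *ℝ γ -ℝ α *ℝ α)
    lemma : ∀ n → seq inner n ≡ seq s[γγ-αα] n
    lemma n = begin
      (a ℚ.+ a) ℚ.* b ℚ.+ fromℕ m ℚ.* (b ℚ.* b)
        ≡⟨ solve 3 (λ a b M → (a :+ a) :* b :+ M :* (b :* b) := b :* ((a :+ M :* b) :+ a)) refl a b (fromℕ m) ⟩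
      b ℚ.* ((a ℚ.+ fromℕ m ℚ.* b) ℚ.+ a)
        ≡⟨ cong (λ c → b ℚ.* (c ℚ.+ a)) (α+mβ≡γ n) ⟩
      b ℚ.* (c ℚ.+ a)
        ≡⟨ solve 3 (λ s c a → (s :* (c :- a)) :* (c :+ a) := s :* (c :* c :- a :* a)) refl m⁻¹ c a ⟩
      m⁻¹ ℚ.* (c ℚ.* c ℚ.- a ℚ.* a) ∎
      where
      open ≡-Reasoning
      a b c : ℚ
      a = seq α n
      b = seq β n
      c = seq γ n

  -- Opaque because the type checker would compare unfolded coordinates
  -- component by component, down to their Cauchy moduli.
  opaque
    ray : ℚ → Fin m → Vector ℝ m
    ray x i k = fromℚ x *ℝ (α *ℝ fromℚ (δ i k) +ℝ β)

    sqDist-ray : ∀ x y i j →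
      Σℝ (λ k → (ray x i k -ℝ ray y j k) *ℝ (ray x i k -ℝ ray y j k)) ≃ fromℚ (raySqDist p r x y (δ i j))
    sqDist-ray x y i j = ≃-trans (Σℝ f) (u *ℝ (α *ℝ α) +ℝ v *ℝ inner) (fromℚ (raySqDist p r x y (δ i j)))
      (≡⇒≃ (Σℝ f) (u *ℝ (α *ℝ α) +ℝ v *ℝ inner) λ n →
        trans (seq-Σℝ f n) (sum-sq-diff (seq α n) (seq β n) x y i j))
      (+ℝ-cong (u *ℝ (α *ℝ α)) (u *ℝ fromℚ p) (v *ℝ inner) (v *ℝ fromℚ r)
        (*ℝ-cong u u (α *ℝ α) (fromℚ p) (≃-refl u) (√-squared p (ℚₚ.<⇒≤ 0<p)))
        (*ℝ-cong v v inner (fromℚ r) (≃-refl v) inner≃r))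
      where
      f : Vector ℝ m
      f k = (ray x i k -ℝ ray y j k) *ℝ (ray x i k -ℝ ray y j k)
      u v : ℝ
      u = fromℚ (x ℚ.* x ℚ.+ y ℚ.* y ℚ.- (x ℚ.* y ℚ.+ x ℚ.* y) ℚ.* δ i j)
      v = fromℚ ((x ℚ.- y) ℚ.* (x ℚ.- y))

    ·-ray : ∀ (a : Vector ℝ m) y j → a · ray y j ≃ fromℚ y *ℝ (α *ℝ a j +ℝ β *ℝ Σℝ a)
    ·-ray a y j = ≡⇒≃ (a · ray y j) (fromℚ y *ℝ (α *ℝ a j +ℝ β *ℝ Σℝ a)) λ n → trans
      (seq-Σℝ (λ k → a k *ℝ ray y j k) n)
      (trans (sum-*-ray (seq α n) (seq β n) y (λ k → seq (a k) n) j)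
        (cong (λ s → y ℚ.* (seq α n ℚ.* seq (a j) n ℚ.+ seq β n ℚ.* s)) (sym (seq-Σℝ a n))))

  dist-ray : ∀ x y i j d → 0ℚ ℚ.≤ d → raySqDist p r x y (δ i j) ≡ d ℚ.* d → dist (ray x i) (ray y j) ≃ fromℚ d
  dist-ray x y i j d 0≤d eq = ≃-trans (dist (ray x i) (ray y j)) (√ (fromℚ (d ℚ.* d))) (fromℚ d)
    (√-cong (Σℝ λ k → (ray x i k -ℝ ray y j k) *ℝ (ray x i k -ℝ ray y j k)) (fromℚ (d ℚ.* d))
      (subst (λ s → Σℝ (λ k → (ray x i k -ℝ ray y j k) *ℝ (ray x i k -ℝ ray y j k)) ≃ fromℚ s)
        eq (sqDist-ray x y i j)))
    (√-of-square d 0≤d)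

  dist-ray-ℕ : ∀ x y i j n → raySqDist p r x y (δ i j) ≡ fromℕ n ℚ.* fromℕ n → dist (ray x i) (ray y j) ≃ fromℤ (+ n)
  dist-ray-ℕ x y i j n = dist-ray x y i j (fromℕ n) (0≤fromℕ n)

  ray-coincident : ∀ x y i j → (∀ k → ray x i k ≃ ray y j k) → raySqDist p r x y (δ i j) ≡ 0ℚ
  ray-coincident x y i j same = fromℚ-injective (raySqDist p r x y (δ i j)) 0ℚ
    (≃-trans (fromℚ (raySqDist p r x y (δ i j))) (Σℝ f) 0ℝ
      (≃-sym (Σℝ f) (fromℚ (raySqDist p r x y (δ i j))) (sqDist-ray x y i j))
      (Σℝ-zero f λ k → *ℝ-zeroʳ (ray x i k -ℝ ray y j k) (ray x i k -ℝ ray y j k)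
        (≃⇒-ℝ≃0 (ray x i k) (ray y j k) (same k))))
    where
    f : Vector ℝ m
    f k = (ray x i k -ℝ ray y j k) *ℝ (ray x i k -ℝ ray y j k)

  -- If a is orthogonal to every ray then so it is to their sum, which is
  -- γ (1, …, 1); hence the coordinates of a add up to 0 and α aᵢ = 0.
  rays-span : ∀ (a : Vector ℝ m) b x .{{_ : ℚ.NonZero x}} i₀ →
    a · ray 0ℚ i₀ ≃ b → (∀ i → a · ray x i ≃ b) → ∀ i → a i ≃ 0ℝ
  rays-span a b x i₀ origin rays i = √-*-cancel p (a i) 0<p αaᵢ≃0
    where
    A : ℝ
    A = Σℝ a
    -- `w j` is the inner product of `a` with the j-th spanning vector.
    w : Vector ℝ m
    w j = α *ℝ a j +ℝ β *ℝ A
    -- The ray point at scale 0 is the origin, so the hyperplane passes through the origin.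
    b≃0 : b ≃ 0ℝ
    b≃0 = ≃-trans b (a · ray 0ℚ i₀) 0ℝ (≃-sym (a · ray 0ℚ i₀) b origin)
      (≃-trans (a · ray 0ℚ i₀) (0ℝ *ℝ w i₀) 0ℝ (·-ray a 0ℚ i₀)
        (≡⇒≃ (0ℝ *ℝ w i₀) 0ℝ λ n → ℚₚ.*-zeroˡ (seq (w i₀) n)))
    w≃0 : ∀ j → w j ≃ 0ℝ
    w≃0 j = fromℚ-*-cancel x (w j)
      (≃-trans (fromℚ x *ℝ w j) (a · ray x j) 0ℝ (≃-sym (a · ray x j) (fromℚ x *ℝ w j) (·-ray a x j))
        (≃-trans (a · ray x j) b 0ℝ (rays j) b≃0))
    γA≡Σw : ∀ n → seq (γ *ℝ A) n ≡ seq (Σℝ w) n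
    γA≡Σw n = sym (begin
      seq (Σℝ w) n
        ≡⟨ seq-Σℝ w n ⟩
      sum (λ j → seq (w j) n)
        ≡⟨ ∑-distrib-+ (λ j → seq α n ℚ.* seq (a j) n) (λ _ → seq β n ℚ.* seq A n) ⟩
      sum (λ j → seq α n ℚ.* seq (a j) n) ℚ.+ sum {m} (λ _ → seq β n ℚ.* seq A n)
        ≡⟨ cong₂ ℚ._+_ (sym (*-distribˡ-sum (seq α n) (λ j → seq (a j) n))) (sum-const m (seq β n ℚ.* seq A n)) ⟩
      seq α n ℚ.* sum (λ j → seq (a j) n) ℚ.+ fromℕ m ℚ.* (seq β n ℚ.* seq A n)
        ≡⟨ cong (λ s → seq α n ℚ.* s ℚ.+ fromℕ m ℚ.* (seq β n ℚ.* seq A n)) (sym (seq-Σℝ a n)) ⟩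
      seq α n ℚ.* seq A n ℚ.+ fromℕ m ℚ.* (seq β n ℚ.* seq A n)
        ≡⟨ solve 4 (λ α A M β → α :* A :+ M :* (β :* A) := (α :+ M :* β) :* A)
             refl (seq α n) (seq A n) (fromℕ m) (seq β n) ⟩
      (seq α n ℚ.+ fromℕ m ℚ.* seq β n) ℚ.* seq A n
        ≡⟨ cong (ℚ._* seq A n) (α+mβ≡γ n) ⟩
      seq γ n ℚ.* seq A n ∎)
      where open ≡-Reasoning
    A≃0 : A ≃ 0ℝ
    A≃0 = √-*-cancel γ² A 0<γ²
      (≃-trans (γ *ℝ A) (Σℝ w) 0ℝ (≡⇒≃ (γ *ℝ A) (Σℝ w) γA≡Σw) (Σℝ-zero w w≃0))
    αaᵢ≃0 : α *ℝ a i ≃ 0ℝ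
    αaᵢ≃0 = ≃-trans (α *ℝ a i) (w i +ℝ (-ℝ β) *ℝ A) 0ℝ
      (≡⇒≃ (α *ℝ a i) (w i +ℝ (-ℝ β) *ℝ A) λ n →
        solve 3 (λ u β A → u := (u :+ β :* A) :+ (:- β) :* A) refl (seq α n ℚ.* seq (a i) n) (seq β n) (seq A n))
      (+ℝ-cong (w i) 0ℝ ((-ℝ β) *ℝ A) 0ℝ (w≃0 i) (*ℝ-zeroʳ (-ℝ β) A A≃0))

  -- The distance table depends only on the two scale indices and on whether the rays agree, so one
  -- finite table serves every m. The origin lies on every ray; `k₀` is the direction formally
  -- assigned to it.
  module Cone
    (scale : Fin 5 → ℚ) (scale-zero : scale zero ≡ 0ℚ) (scale-nonZero : ℚ.NonZero (scale (suc zero)))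
    (distance : Bool → Fin 5 → Fin 5 → ℕ)
    (distance-correct : ∀ same s t → raySqDist p r (scale s) (scale t) (if same then 1ℚ else 0ℚ)
      ≡ fromℕ (distance same s t) ℚ.* fromℕ (distance same s t))
    (distance-zero : ∀ same s t → distance same s t ≡ 0 → s ≡ t)
    (otherRay-zero : ∀ s t → distance false s t ≡ 0 → s ≡ zero)
    (k₀ : Fin m) where

    direction : Label m → Fin m
    direction (inj₁ (_ , k)) = k
    direction (inj₂ _)       = k₀

    labelDistance : Label m → Label m → ℕ
    labelDistance a b = distance (does (direction a Finₚ.≟ direction b)) (scaleIndex a) (scaleIndex b)

    labelDistance-zero : ∀ (a b : Label m) → labelDistance a b ≡ 0 → a ≡ b
    labelDistance-zero (inj₁ (s , k)) (inj₁ (t , j)) d≡0 with k Finₚ.≟ j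
    ... | yes refl = cong (λ u → inj₁ (u , k)) (Finₚ.suc-injective (distance-zero true (suc s) (suc t) d≡0))
    -- Different rays meet only at the origin, whose index 0 is not of the form `suc s`.
    ... | no  _    = contradiction (otherRay-zero (suc s) (suc t) d≡0) λ ()
    labelDistance-zero (inj₁ (s , k)) (inj₂ _) d≡0 =
      contradiction (distance-zero (does (k Finₚ.≟ k₀)) (suc s) zero d≡0) λ ()
    labelDistance-zero (inj₂ _) (inj₁ (t , k)) d≡0 =
      contradiction (distance-zero (does (k₀ Finₚ.≟ k)) zero (suc t) d≡0) λ ()
    labelDistance-zero (inj₂ zero) (inj₂ zero) _ = refl

    labelPoint : Label m → Vector ℝ m
    labelPoint a = ray (scale (scaleIndex a)) (direction a)

    opaque
      points : Fin (4 * m + 1) → Vector ℝ m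
      points i = labelPoint (label m i)

      points≡ : ∀ i → points i ≡ ray (scale (scaleIndex (label m i))) (direction (label m i))
      points≡ i = refl

    points-unlabel : ∀ u → points (unlabel m u) ≡ ray (scale (scaleIndex u)) (direction u)
    points-unlabel u = trans (points≡ (unlabel m u)) (cong labelPoint (label-unlabel m u))

    pointDistance : Fin (4 * m + 1) → Fin (4 * m + 1) → ℕ
    pointDistance i j = labelDistance (label m i) (label m j)

    raySqDist-label : ∀ a b →
      raySqDist p r (scale (scaleIndex a)) (scale (scaleIndex b)) (δ (direction a) (direction b))
        ≡ fromℕ (labelDistance a b) ℚ.* fromℕ (labelDistance a b)
    raySqDist-label a b = distance-correct (does (direction a Finₚ.≟ direction b)) (scaleIndex a) (scaleIndex b)

    dist-labels : ∀ a b → dist (ray (scale (scaleIndex a)) (direction a)) (ray (scale (scaleIndex b)) (direction b))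
      ≃ fromℤ (+ labelDistance a b)
    dist-labels a b = dist-ray-ℕ (scale (scaleIndex a)) (scale (scaleIndex b)) (direction a) (direction b)
      (labelDistance a b) (raySqDist-label a b)

    dist-points : ∀ i j → dist (points i) (points j) ≃ fromℤ (+ pointDistance i j)
    dist-points i j = subst₂ (λ P Q → dist P Q ≃ fromℤ (+ pointDistance i j))
      (sym (points≡ i)) (sym (points≡ j)) (dist-labels (label m i) (label m j))

    points-distinct : ∀ i j → (∀ k → points i k ≃ points j k) → i ≡ j
    points-distinct i j same = begin
      i                      ≡⟨ unlabel-label m i ⟨
      unlabel m (label m i)  ≡⟨ cong (unlabel m) (labelDistance-zero a b d≡0) ⟩
      unlabel m (label m j)  ≡⟨ unlabel-label m j ⟩
      j                      ∎
      where
      open ≡-Reasoning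
      a b : Label m
      a = label m i
      b = label m j
      d≡0 : labelDistance a b ≡ 0
      d≡0 = fromℕ-square≡0 (labelDistance a b) (trans (sym (raySqDist-label a b))
        (ray-coincident (scale (scaleIndex a)) (scale (scaleIndex b)) (direction a) (direction b)
          (subst₂ (λ P Q → ∀ k → P k ≃ Q k) (points≡ i) (points≡ j) same)))

    -- The origin and the m points of scale index 1, one on each ray, already affinely span the
    -- space.
    points-nondegenerate : ¬ InHyperplane points
    points-nondegenerate (a , b , a≄0 , plane) = a≄0
      (rays-span a b (scale (suc zero)) {{scale-nonZero}} k₀
        (at (inj₂ zero) (ray 0ℚ k₀)
          (trans (points-unlabel (inj₂ zero)) (cong (λ x → ray x k₀) scale-zero)))
        (λ k → at (inj₁ (zero , k)) (ray (scale (suc zero)) k) (points-unlabel (inj₁ (zero , k)))))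
      where
      at : ∀ u P → points (unlabel m u) ≡ P → a · P ≃ b
      at u P eq = subst (λ P → a · P ≃ b) eq (plane (unlabel m u))

    -- The maximum of the table has to be attained on a single ray, so that a pair of points on the
    -- ray `k₀` realises it.
    coneOfDiameter : ∀ s t D → distance true (suc s) (suc t) ≡ D → (∀ same s t → distance same s t ≤ D) →
      Σ (IntegralPointSet m (4 * m + 1)) λ P → IsDiameter P (fromℤ (+ D))
    coneOfDiameter s t D attained bound = integralPointSetOfDiameter
      points pointDistance dist-points points-distinct points-nondegenerate
      D (unlabel m a) (unlabel m b)
      (trans (cong₂ labelDistance (label-unlabel m a) (label-unlabel m b))
        (trans (cong (λ same → distance same (suc s) (suc t)) (dec-true (k₀ Finₚ.≟ k₀) refl)) attained))
      (λ i j → bound (does (direction (label m i) Finₚ.≟ direction (label m j)))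
        (scaleIndex (label m i)) (scaleIndex (label m j)))
      where
      a b : Label m
      a = inj₁ (s , k₀)
      b = inj₁ (t , k₀)

-- Numerical data: the five scales and their distances

-- Index 0 is the origin. The other four values were found by a computer search.
scale : Fin 5 → ℚ
scale s = lookup (+ 0 ∷ ℤ.-[1+ 32 ] ∷ + 12 ∷ + 44 ∷ + 63 ∷ []) s ℚ./ 1

-- For scales x and y the entries are 4|x - y| and √(16(x - y)² + 25xy); the diagonal of `otherRay`
-- is thus 5|x|. The rows and columns of index 0 agree because the origin lies on every ray.
sameRay otherRay : Vec (Vec ℕ 5) 5
sameRay =
  (  0 ∷ 132 ∷  48 ∷ 176 ∷ 252 ∷ []) ∷
  (132 ∷   0 ∷ 180 ∷ 308 ∷ 384 ∷ []) ∷
  ( 48 ∷ 180 ∷   0 ∷ 128 ∷ 204 ∷ []) ∷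
  (176 ∷ 308 ∷ 128 ∷   0 ∷  76 ∷ []) ∷
  (252 ∷ 384 ∷ 204 ∷  76 ∷   0 ∷ []) ∷ []
otherRay =
  (  0 ∷ 132 ∷  48 ∷ 176 ∷ 252 ∷ []) ∷
  (132 ∷ 165 ∷ 150 ∷ 242 ∷ 309 ∷ []) ∷
  ( 48 ∷ 150 ∷  60 ∷ 172 ∷ 246 ∷ []) ∷
  (176 ∷ 242 ∷ 172 ∷ 220 ∷ 274 ∷ []) ∷
  (252 ∷ 309 ∷ 246 ∷ 274 ∷ 315 ∷ []) ∷ []

distance : Bool → Fin 5 → Fin 5 → ℕ
distance same s t = lookup (lookup (if same then sameRay else otherRay) s) t

-- With p = 25/2 and r = 7/2 the spanning vectors have squared norm p + r = 4² and pairwise squared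
-- distance 2p = 5². For each Boolean the 25 rational equations are verified by decision.
distance-correct : ∀ same s t → raySqDist (+ 25 ℚ./ 2) (+ 7 ℚ./ 2) (scale s) (scale t) (if same then 1ℚ else 0ℚ)
  ≡ fromℕ (distance same s t) ℚ.* fromℕ (distance same s t)
distance-correct true  = toWitness {a? = Finₚ.all? λ s → Finₚ.all? λ t → _ ℚₚ.≟ _} _
distance-correct false = toWitness {a? = Finₚ.all? λ s → Finₚ.all? λ t → _ ℚₚ.≟ _} _

distance-bound : ∀ same s t → distance same s t ≤ 384
distance-bound true  = toWitness {a? = Finₚ.all? λ s → Finₚ.all? λ t → _ ℕₚ.≤? _} _
distance-bound false = toWitness {a? = Finₚ.all? λ s → Finₚ.all? λ t → _ ℕₚ.≤? _} _

distance-zero : ∀ same s t → distance same s t ≡ 0 → s ≡ t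
distance-zero true  = toWitness {a? = Finₚ.all? λ s → Finₚ.all? λ t → (_ ℕₚ.≟ _) →-dec (s Finₚ.≟ t)} _
distance-zero false = toWitness {a? = Finₚ.all? λ s → Finₚ.all? λ t → (_ ℕₚ.≟ _) →-dec (s Finₚ.≟ t)} _

otherRay-zero : ∀ s t → distance false s t ≡ 0 → s ≡ zero
otherRay-zero = toWitness {a? = Finₚ.all? λ s → Finₚ.all? λ t → (_ ℕₚ.≟ _) →-dec (s Finₚ.≟ zero)} _

coneOfDiameter384 : ∀ l →
  Σ (IntegralPointSet (suc l) (4 * suc l + 1)) λ P → IsDiameter P (fromℤ (+ 384))
-- `step l` is 1/(l + 1), the inverse of the dimension.
coneOfDiameter384 l = Rays.Cone.coneOfDiameter (suc l) (step l) (suc*step≡1 l)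
  (+ 25 ℚ./ 2) (+ 7 ℚ./ 2) (ℚₚ.positive⁻¹ (+ 25 ℚ./ 2)) (ℚₚ.nonNegative⁻¹ (+ 7 ℚ./ 2))
  scale refl _ distance distance-correct distance-zero otherRay-zero zero
  -- These are the scales -33 and 63 on one ray, at distance 4 · 96 = 384; the coneless index 0 of
  -- the origin is skipped, hence the shift by one.
  zero (suc (suc (suc zero))) 384 refl distance-bound

384≤1260 : 384 ≤ 1260
384≤1260 = toWitness {a? = 384 ℕₚ.≤? 1260} _

mainTheorem6 : ∀ (m : ℕ) → 2 ≤ m →
    (Σ (IntegralPointSet m (4 * m + 1)) λ P → ∃[ D ] IsDiameter P D × D ≤ℝ fromℤ (+ 1260)) ×
    ¬ ¬ (∃[ d ] IsMinimalDiameter m (4 * m + 1) d × d ≤ℝ fromℤ (+ 1260))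
mainTheorem6 (suc l) _ = diameterBounds 384 1260 384≤1260 (coneOfDiameter384 l)
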